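{- No $[10,10,16]_{\mathbb{Z}}$ formula is a restriction of any Hurwitz–Radon formula.
   Context: All norms are Euclidean. For positive integers $r,s,n$, an $[r,s,n]_{\mathbb{R}}$ formula is (equivalently) a normed bilinear map of size $[r,s,n]$, i.e. an $\mathbb{R}$-bilinear map $f:\mathbb{R}^r\times\mathbb{R}^s\to\mathbb{R}^n$ with $|f(x,y)|=|x|\,|y|$ for all $x\in\mathbb{R}^r$, $y\in\mathbb{R}^s$. Writing $f=(z_1,\dots,z_n)$, each $z_k(x,y)$ is a bilinear form in the coordinates of $x$ and $y$. An $[r,s,n]_{\mathbb{Z}}$ formula is such a formula in which every $z_k$ has integer coefficients (with respect to the standard coordinates). Hurwitz–Radon function and formulas: for a positive integer $m=2^{4a+b}m_0$ with $m_0$ odd, $a\ge 0$ and $0\le b\le 3$, put $\rho(m)=8a+2^b$. A Hurwitz–Radon formula is a $[\rho(m),m,m]_{\mathbb{R}}$ formula for some positive integer $m$. Restriction: Let $F:\mathbb{R}^h\times\mathbb{R}^m\to\mathbb{R}^m$ be a normed bilinear map. A normed bilinear map $g:\mathbb{R}^r\times\mathbb{R}^s\to\mathbb{R}^n$ is a restriction of $F$ if there are linear subspaces $X\subseteq\mathbb{R}^h$, $Y\subseteq\mathbb{R}^m$, $Z\subseteq\mathbb{R}^m$ of dimensions $r,s,n$ respectively with $F(X\times Y)\subseteq Z$, and linear isometries (onto) $\alpha:\mathbb{R}^r\to X$, $\beta:\mathbb{R}^s\to Y$, $\gamma:\mathbb{R}^n\to Z$ such that $\gamma(g(x,y))=F(\alpha(x),\beta(y))$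 for all $x\in\mathbb{R}^r$, $y\in\mathbb{R}^s$. -}

module Defs where

open import Algebra.Bundles using (CommutativeRing)
open import Algebra.Module.Bundles using (LeftModule)
open import Algebra.Module.Morphism.Structures using (module LeftModuleMorphisms)
open import Data.Bool.Base using (if_then_else_)
open import Data.Fin.Base using (Fin)
open import Data.Integer.Base using (ℤ; +_)
open import Data.Nat.Base as ℕ using (ℕ; zero; suc)
open import Data.Nat.Divisibility using (_∣_)
import Data.Integer.Base as ℤ
import Data.Integer.Properties as ℤₚ
import Data.Nat.Properties as ℕₚ
open import Data.Product.Base using (∃; _×_; _,_; proj₁; proj₂; map₂)
open import Data.Rational.Base as ℚ using (ℚ; 0ℚ; 1ℚ; ½; _/_; _+_; _*_; -_; _-_; ∣_∣; _<_; _≤_; _⊔_; 1/_)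
import Data.Rational.Properties as ℚₚ
import Data.Rational.Unnormalised.Base as ℚᵘ
import Data.Rational.Unnormalised.Properties as ℚᵘₚ
open import Data.Rational.Solver using (module +-*-Solver)
open import Data.Sum.Base using (_⊎_; inj₁; inj₂)
open import Data.Vec.Functional using (Vector)
open import Level using (0ℓ)
open import Relation.Binary.Core using (Rel)
open import Relation.Binary.PropositionalEquality using (_≡_; refl; sym; trans; cong; cong₂; subst; subst₂)
open import Relation.Nullary using (¬_; Dec; yes; no; ⌊_⌋)
open import Relation.Nullary.Negation using (contradiction)
open import Relation.Unary using (Pred)

open +-*-Solver using (solve; _:+_; _:*_; _:-_; :-_; _:=_)

private
  module ≤-Reasoning = ℚₚ.≤-Reasoning

private
  0<½ : 0ℚ < ½
  0<½ = ℚₚ.positive⁻¹ ½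

  0<* : ∀ {p q} → 0ℚ < p → 0ℚ < q → 0ℚ < p * q
  0<* {p} {q} 0<p 0<q = ℚₚ.positive⁻¹ (p * q)
    {{ℚₚ.pos*pos⇒pos p {{ℚ.positive 0<p}} q {{ℚ.positive 0<q}}}}

  0<+ : ∀ {p q} → 0ℚ < p → 0ℚ < q → 0ℚ < p + q
  0<+ = ℚₚ.+-mono-<

  ½+½ : ∀ ε → ½ * ε + ½ * ε ≡ ε
  ½+½ ε = trans (sym (ℚₚ.*-distribʳ-+ ε ½ ½)) (ℚₚ.*-identityˡ ε)

  *-mono-≤ : ∀ {p q r s} → 0ℚ ≤ p → 0ℚ ≤ s → p ≤ q → r ≤ s → p * r ≤ q * s
  *-mono-≤ {p} {q} {r} {s} 0≤p 0≤s p≤q r≤s = ℚₚ.≤-trans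
    (ℚₚ.*-monoˡ-≤-nonNeg p {{ℚ.nonNegative 0≤p}} r≤s)
    (ℚₚ.*-monoʳ-≤-nonNeg s {{ℚ.nonNegative 0≤s}} p≤q)

  ∣p-p∣ : ∀ p → ∣ p - p ∣ ≡ 0ℚ
  ∣p-p∣ p = cong ∣_∣ (ℚₚ.+-inverseʳ p)

  ∣p-q∣≡∣q-p∣ : ∀ p q → ∣ p - q ∣ ≡ ∣ q - p ∣
  ∣p-q∣≡∣q-p∣ p q = trans (sym (ℚₚ.∣-p∣≡∣p∣ (p - q)))
    (cong ∣_∣ (solve 2 (λ p q → :- (p :- q) := q :- p) refl p q))

  triangle : ∀ p q r {δ ε} → ∣ p - q ∣ < δ → ∣ q - r ∣ < ε → ∣ p - r ∣ < δ + ε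
  triangle p q r {δ} {ε} pq qr = begin-strict
    ∣ p - r ∣               ≡⟨ cong ∣_∣ (solve 3 (λ p q r → p :- r := (p :- q) :+ (q :- r)) refl p q r) ⟩
    ∣ (p - q) + (q - r) ∣   ≤⟨ ℚₚ.∣p+q∣≤∣p∣+∣q∣ (p - q) (q - r) ⟩
    ∣ p - q ∣ + ∣ q - r ∣   <⟨ ℚₚ.+-mono-< pq qr ⟩
    δ + ε                   ∎
    where open ≤-Reasoning

  p≤∣p∣ : ∀ p → p ≤ ∣ p ∣
  p≤∣p∣ p with ℚₚ.≤-total 0ℚ p
  ... | inj₁ 0≤p = ℚₚ.≤-reflexive (sym (ℚₚ.0≤p⇒∣p∣≡p 0≤p))
  ... | inj₂ p≤0 = ℚₚ.≤-trans p≤0 (ℚₚ.0≤∣p∣ p)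

  ∣p-q∣<ε⇒p<q+ε : ∀ p q {ε} → ∣ p - q ∣ < ε → p < q + ε
  ∣p-q∣<ε⇒p<q+ε p q {ε} h = begin-strict
    p              ≡⟨ solve 2 (λ p q → p := q :+ (p :- q)) refl p q ⟩
    q + (p - q)    <⟨ ℚₚ.+-monoʳ-< q (ℚₚ.≤-<-trans (p≤∣p∣ (p - q)) h) ⟩
    q + ε          ∎
    where open ≤-Reasoning

  p<q+ε⇒p-q<ε : ∀ p q {ε} → p < q + ε → p - q < ε
  p<q+ε⇒p-q<ε p q {ε} h = begin-strict
    p - q          <⟨ ℚₚ.+-monoˡ-< (- q) h ⟩
    (q + ε) - q    ≡⟨ solve 2 (λ q ε → (q :+ ε) :- q := ε) refl q ε ⟩
    ε              ∎
    where open ≤-Reasoning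

  within : ∀ p q {ε} → p < q + ε → q < p + ε → ∣ p - q ∣ < ε
  within p q {ε} p< q< with ℚₚ.∣p∣≡p∨∣p∣≡-p (p - q)
  ... | inj₁ eq = subst (_< ε) (sym eq) (p<q+ε⇒p-q<ε p q p<)
  ... | inj₂ eq = subst (_< ε)
    (sym (trans eq (solve 2 (λ p q → :- (p :- q) := q :- p) refl p q)))
    (p<q+ε⇒p-q<ε q p q<)

  +-close : ∀ p p′ q q′ {δ ε} → ∣ p - p′ ∣ < δ → ∣ q - q′ ∣ < ε →
            ∣ (p + q) - (p′ + q′) ∣ < δ + ε
  +-close p p′ q q′ {δ} {ε} hp hq = begin-strict
    ∣ (p + q) - (p′ + q′) ∣     ≡⟨ cong ∣_∣ (solve 4 (λ p p′ q q′ → (p :+ q) :- (p′ :+ q′) := (p :- p′) :+ (q :- q′)) refl p p′ q q′) ⟩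
    ∣ (p - p′) + (q - q′) ∣     ≤⟨ ℚₚ.∣p+q∣≤∣p∣+∣q∣ (p - p′) (q - q′) ⟩
    ∣ p - p′ ∣ + ∣ q - q′ ∣     <⟨ ℚₚ.+-mono-< hp hq ⟩
    δ + ε                       ∎
    where open ≤-Reasoning

  neg-close : ∀ p q {ε} → ∣ p - q ∣ < ε → ∣ (- p) - (- q) ∣ < ε
  neg-close p q {ε} = subst (_< ε)
    (trans (∣p-q∣≡∣q-p∣ p q) (cong ∣_∣ (solve 2 (λ p q → q :- p := (:- p) :- (:- q)) refl p q)))

  *-close : ∀ p p′ q q′ {B C ε} → 0ℚ < B → 0ℚ < C → ∣ p ∣ < B → ∣ q′ ∣ < C →
            ∣ p - p′ ∣ < ε → ∣ q - q′ ∣ < ε → ∣ p * q - p′ * q′ ∣ ≤ (B + C) * ε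
  *-close p p′ q q′ {B} {C} {ε} 0<B 0<C hp hq′ δp δq = begin
    ∣ p * q - p′ * q′ ∣                        ≡⟨ cong ∣_∣ (solve 4 (λ p p′ q q′ → p :* q :- p′ :* q′ := p :* (q :- q′) :+ q′ :* (p :- p′)) refl p p′ q q′) ⟩
    ∣ p * (q - q′) + q′ * (p - p′) ∣           ≤⟨ ℚₚ.∣p+q∣≤∣p∣+∣q∣ (p * (q - q′)) (q′ * (p - p′)) ⟩
    ∣ p * (q - q′) ∣ + ∣ q′ * (p - p′) ∣       ≡⟨ cong₂ _+_ (ℚₚ.∣p*q∣≡∣p∣*∣q∣ p (q - q′)) (ℚₚ.∣p*q∣≡∣p∣*∣q∣ q′ (p - p′)) ⟩
    ∣ p ∣ * ∣ q - q′ ∣ + ∣ q′ ∣ * ∣ p - p′ ∣   ≤⟨ ℚₚ.+-mono-≤ (step hp δq) (step hq′ δp) ⟩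
    B * ε + C * ε                              ≡⟨ sym (ℚₚ.*-distribʳ-+ ε B C) ⟩
    (B + C) * ε                                ∎
    where
    open ≤-Reasoning
    step : ∀ {u v D} → ∣ u ∣ < D → ∣ v ∣ < ε → ∣ u ∣ * ∣ v ∣ ≤ D * ε
    step {u} {v} hu hv = *-mono-≤ (ℚₚ.0≤∣p∣ u)
      (ℚₚ.≤-trans (ℚₚ.0≤∣p∣ v) (ℚₚ.<⇒≤ hv)) (ℚₚ.<⇒≤ hu) (ℚₚ.<⇒≤ hv)

  divide : ∀ {K ε} → 0ℚ < K → 0ℚ < ε → ∃ λ δ → 0ℚ < δ × K * δ < ε
  divide {K} {ε} 0<K 0<ε = δ , 0<δ , Kδ<ε
    where
    instance
      K>0 = ℚ.positive 0<K
      K≢0 = ℚₚ.pos⇒nonZero K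
    δ = ½ * ε * 1/ K
    0<δ : 0ℚ < δ
    0<δ = 0<* (0<* 0<½ 0<ε) (ℚₚ.positive⁻¹ (1/ K) {{ℚₚ.1/pos⇒pos K}})
    Kδ<ε : K * δ < ε
    Kδ<ε = begin-strict
      K * (½ * ε * 1/ K)     ≡⟨ solve 3 (λ K e i → K :* (e :* i) := e :* (K :* i)) refl K (½ * ε) (1/ K) ⟩
      ½ * ε * (K * 1/ K)     ≡⟨ cong (½ * ε *_) (ℚₚ.*-inverseʳ K) ⟩
      ½ * ε * 1ℚ             ≡⟨ ℚₚ.*-identityʳ (½ * ε) ⟩
      ½ * ε                  ≡⟨ sym (ℚₚ.+-identityʳ (½ * ε)) ⟩
      ½ * ε + 0ℚ             <⟨ ℚₚ.+-monoʳ-< (½ * ε) (0<* 0<½ 0<ε) ⟩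
      ½ * ε + ½ * ε          ≡⟨ ½+½ ε ⟩
      ε                      ∎
      where open ≤-Reasoning

  _and_ : ∀ {P Q : ℕ → Set} → (∃ λ N → ∀ n → N ℕ.≤ n → P n) → (∃ λ N → ∀ n → N ℕ.≤ n → Q n) →
          ∃ λ N → ∀ n → N ℕ.≤ n → P n × Q n
  (M , p) and (N , q) = M ℕ.⊔ N , λ n h →
    p n (ℕₚ.≤-trans (ℕₚ.m≤m⊔n M N) h) , q n (ℕₚ.≤-trans (ℕₚ.m≤n⊔m M N) h)

  eventually : ∀ {P Q : ℕ → Set} → (∀ n → P n → Q n) →
               (∃ λ N → ∀ n → N ℕ.≤ n → P n) → ∃ λ N → ∀ n → N ℕ.≤ n → Q n
  eventually f (N , p) = N , λ n h → f n (p n h)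

  eventually₂ : ∀ {P Q R : ℕ → ℕ → Set} → (∀ m n → P m n → Q m n → R m n) →
            (∃ λ N → ∀ m n → N ℕ.≤ m → N ℕ.≤ n → P m n) →
            (∃ λ N → ∀ m n → N ℕ.≤ m → N ℕ.≤ n → Q m n) →
            ∃ λ N → ∀ m n → N ℕ.≤ m → N ℕ.≤ n → R m n
  eventually₂ f (M , p) (N , q) = M ℕ.⊔ N , λ m n hm hn → f m n
    (p m n (ℕₚ.≤-trans (ℕₚ.m≤m⊔n M N) hm) (ℕₚ.≤-trans (ℕₚ.m≤m⊔n M N) hn))
    (q m n (ℕₚ.≤-trans (ℕₚ.m≤n⊔m M N) hm) (ℕₚ.≤-trans (ℕₚ.m≤n⊔m M N) hn))

-- The reals are the Cauchy sequences of rationals, with the setoid equality _≃_.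

IsCauchy : (ℕ → ℚ) → Set
IsCauchy s = ∀ ε → 0ℚ < ε → ∃ λ N → ∀ m n → N ℕ.≤ m → N ℕ.≤ n → ∣ s m - s n ∣ < ε

record ℝ : Set where
  constructor mkℝ
  field
    seq    : ℕ → ℚ
    cauchy : IsCauchy seq

open ℝ public

infix 4 _≃_

_≃_ : Rel ℝ 0ℓ
x ≃ y = ∀ ε → 0ℚ < ε → ∃ λ N → ∀ n → N ℕ.≤ n → ∣ seq x n - seq y n ∣ < ε

abstract
  pointwise : ∀ {x y} → (∀ n → seq x n ≡ seq y n) → x ≃ y
  pointwise {x} {y} eq ε 0<ε = 0 , λ n _ → subst (_< ε)
    (sym (trans (cong (λ q → ∣ seq x n - q ∣) (sym (eq n))) (∣p-p∣ (seq x n)))) 0<ε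

  ≃-refl : ∀ {x} → x ≃ x
  ≃-refl {x} = pointwise {x} {x} λ _ → refl

  ≃-sym : ∀ {x y} → x ≃ y → y ≃ x
  ≃-sym {x} {y} h ε 0<ε = eventually
    (λ n → subst (_< ε) (∣p-q∣≡∣q-p∣ (seq x n) (seq y n))) (h ε 0<ε)

  ≃-trans : ∀ {x y z} → x ≃ y → y ≃ z → x ≃ z
  ≃-trans {x} {y} {z} h k ε 0<ε = eventually
    (λ n (p , q) → subst (∣ seq x n - seq z n ∣ <_) (½+½ ε)
      (triangle (seq x n) (seq y n) (seq z n) p q))
    (h (½ * ε) (0<* 0<½ 0<ε) and k (½ * ε) (0<* 0<½ 0<ε))

  bounded : ∀ x → ∃ λ B → 0ℚ < B × (∃ λ N → ∀ n → N ℕ.≤ n → ∣ seq x n ∣ < B)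
  bounded x = ∣ seq x N ∣ + 1ℚ , 0<B , N , λ n N≤n → begin-strict
    ∣ seq x n ∣                            ≡⟨ cong ∣_∣ (solve 2 (λ a b → a := b :+ (a :- b)) refl (seq x n) (seq x N)) ⟩
    ∣ seq x N + (seq x n - seq x N) ∣      ≤⟨ ℚₚ.∣p+q∣≤∣p∣+∣q∣ (seq x N) (seq x n - seq x N) ⟩
    ∣ seq x N ∣ + ∣ seq x n - seq x N ∣    <⟨ ℚₚ.+-monoʳ-< ∣ seq x N ∣ (proj₂ near n N N≤n ℕₚ.≤-refl) ⟩
    ∣ seq x N ∣ + 1ℚ                       ∎
    where
    open ≤-Reasoning
    near : ∃ λ N → ∀ m n → N ℕ.≤ m → N ℕ.≤ n → ∣ seq x m - seq x n ∣ < 1ℚ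
    near = cauchy x 1ℚ (ℚₚ.positive⁻¹ 1ℚ)
    N : ℕ
    N = proj₁ near
    0<B : 0ℚ < ∣ seq x N ∣ + 1ℚ
    0<B = ℚₚ.+-mono-≤-< (ℚₚ.0≤∣p∣ (seq x N)) (ℚₚ.positive⁻¹ 1ℚ)

abstract
  constant-isCauchy : ∀ q → IsCauchy (λ _ → q)
  constant-isCauchy q ε 0<ε = 0 , λ _ _ _ _ → subst (_< ε) (sym (∣p-p∣ q)) 0<ε

  +-isCauchy : ∀ x y → IsCauchy (λ n → seq x n + seq y n)
  +-isCauchy x y ε 0<ε = eventually₂
    (λ m n p q → subst (∣ (seq x m + seq y m) - (seq x n + seq y n) ∣ <_) (½+½ ε)
      (+-close (seq x m) (seq x n) (seq y m) (seq y n) p q))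
    (cauchy x (½ * ε) (0<* 0<½ 0<ε)) (cauchy y (½ * ε) (0<* 0<½ 0<ε))

  neg-isCauchy : ∀ x → IsCauchy (λ n → - seq x n)
  neg-isCauchy x ε 0<ε = map₂
    (λ p m n hm hn → neg-close (seq x m) (seq x n) (p m n hm hn)) (cauchy x ε 0<ε)

  *-isCauchy : ∀ x y → IsCauchy (λ n → seq x n * seq y n)
  *-isCauchy x y ε 0<ε =
    let (B , 0<B , b) = bounded x
        (C , 0<C , c) = bounded y
        (δ , 0<δ , Kδ<ε) = divide (0<+ 0<B 0<C) 0<ε
    in eventually₂
      (λ m n (p , p<B) (q , q<C) → ℚₚ.≤-<-trans
        (*-close (seq x m) (seq x n) (seq y m) (seq y n) 0<B 0<C p<B q<C p q) Kδ<ε)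
      (eventually₂ (λ _ _ → _,_) (cauchy x δ 0<δ) (map₂ (λ b m n hm hn → b m hm) b))
      (eventually₂ (λ _ _ → _,_) (cauchy y δ 0<δ) (map₂ (λ c m n hm hn → c n hn) c))

fromℚ : ℚ → ℝ
fromℚ q = mkℝ (λ _ → q) (constant-isCauchy q)

fromℤ : ℤ → ℝ
fromℤ z = fromℚ (z / 1)

infixl 6 _+ᴿ_
infixl 7 _*ᴿ_
infix  8 -ᴿ_

_+ᴿ_ : ℝ → ℝ → ℝ
x +ᴿ y = mkℝ (λ n → seq x n + seq y n) (+-isCauchy x y)

-ᴿ_ : ℝ → ℝ
-ᴿ x = mkℝ (λ n → - seq x n) (neg-isCauchy x)

_*ᴿ_ : ℝ → ℝ → ℝ
x *ᴿ y = mkℝ (λ n → seq x n * seq y n) (*-isCauchy x y)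

abstract
  +ᴿ-cong : ∀ {x x′ y y′} → x ≃ x′ → y ≃ y′ → x +ᴿ y ≃ x′ +ᴿ y′
  +ᴿ-cong {x} {x′} {y} {y′} h k ε 0<ε = eventually
    (λ n (p , q) → subst (∣ (seq x n + seq y n) - (seq x′ n + seq y′ n) ∣ <_) (½+½ ε)
      (+-close (seq x n) (seq x′ n) (seq y n) (seq y′ n) p q))
    (h (½ * ε) (0<* 0<½ 0<ε) and k (½ * ε) (0<* 0<½ 0<ε))

  -ᴿ-cong : ∀ {x y} → x ≃ y → -ᴿ x ≃ -ᴿ y
  -ᴿ-cong {x} {y} h ε 0<ε = eventually (λ n → neg-close (seq x n) (seq y n)) (h ε 0<ε)

  *ᴿ-cong : ∀ {x x′ y y′} → x ≃ x′ → y ≃ y′ → x *ᴿ y ≃ x′ *ᴿ y′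
  *ᴿ-cong {x} {x′} {y} {y′} h k ε 0<ε =
    let (B , 0<B , b) = bounded x
        (C , 0<C , c) = bounded y′
        (δ , 0<δ , Kδ<ε) = divide (0<+ 0<B 0<C) 0<ε
    in eventually
      (λ n ((pb , pc) , (ph , pk)) → ℚₚ.≤-<-trans
        (*-close (seq x n) (seq x′ n) (seq y n) (seq y′ n) 0<B 0<C pb pc ph pk) Kδ<ε)
      ((b and c) and (h δ 0<δ and k δ 0<δ))

ℝ-commutativeRing : CommutativeRing 0ℓ 0ℓ
ℝ-commutativeRing = record
  { Carrier = ℝ
  ; _≈_ = _≃_
  ; _+_ = _+ᴿ_
  ; _*_ = _*ᴿ_
  ; -_ = -ᴿ_
  ; 0# = fromℚ 0ℚ
  ; 1# = fromℚ 1ℚ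
  ; isCommutativeRing = record
    { isRing = record
      { +-isAbelianGroup = record
        { isGroup = record
          { isMonoid = record
            { isSemigroup = record
              { isMagma = record
                { isEquivalence = record
                  { refl = λ {x} → ≃-refl {x}
                  ; sym = λ {x} {y} → ≃-sym {x} {y}
                  ; trans = λ {x} {y} {z} → ≃-trans {x} {y} {z}
                  }
                ; ∙-cong = λ {x} {x′} {y} {y′} → +ᴿ-cong {x} {x′} {y} {y′}
                }
              ; assoc = λ x y z → pointwise {(x +ᴿ y) +ᴿ z} {x +ᴿ (y +ᴿ z)} λ n → ℚₚ.+-assoc (seq x n) (seq y n) (seq z n)
              }
            ; identity = (λ x → pointwise {fromℚ 0ℚ +ᴿ x} {x} λ n → ℚₚ.+-identityˡ (seq x n))
                       , (λ x → pointwise {x +ᴿ fromℚ 0ℚ} {x} λ n → ℚₚ.+-identityʳ (seq x n))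
            }
          ; inverse = (λ x → pointwise {(-ᴿ x) +ᴿ x} {fromℚ 0ℚ} λ n → ℚₚ.+-inverseˡ (seq x n))
                    , (λ x → pointwise {x +ᴿ (-ᴿ x)} {fromℚ 0ℚ} λ n → ℚₚ.+-inverseʳ (seq x n))
          ; ⁻¹-cong = λ {x} {y} → -ᴿ-cong {x} {y}
          }
        ; comm = λ x y → pointwise {x +ᴿ y} {y +ᴿ x} λ n → ℚₚ.+-comm (seq x n) (seq y n)
        }
      ; *-cong = λ {x} {x′} {y} {y′} → *ᴿ-cong {x} {x′} {y} {y′}
      ; *-assoc = λ x y z → pointwise {(x *ᴿ y) *ᴿ z} {x *ᴿ (y *ᴿ z)} λ n → ℚₚ.*-assoc (seq x n) (seq y n) (seq z n)
      ; *-identity = (λ x → pointwise {fromℚ 1ℚ *ᴿ x} {x} λ n → ℚₚ.*-identityˡ (seq x n))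
                   , (λ x → pointwise {x *ᴿ fromℚ 1ℚ} {x} λ n → ℚₚ.*-identityʳ (seq x n))
      ; distrib = (λ x y z → pointwise {x *ᴿ (y +ᴿ z)} {x *ᴿ y +ᴿ x *ᴿ z} λ n → ℚₚ.*-distribˡ-+ (seq x n) (seq y n) (seq z n))
                , (λ x y z → pointwise {(y +ᴿ z) *ᴿ x} {y *ᴿ x +ᴿ z *ᴿ x} λ n → ℚₚ.*-distribʳ-+ (seq x n) (seq y n) (seq z n))
      }
    ; *-comm = λ x y → pointwise {x *ᴿ y} {y *ᴿ x} λ n → ℚₚ.*-comm (seq x n) (seq y n)
    }
  }

-- sqrtApprox q n is the greatest multiple p of 1/(n+1) with p² ≤ q, and 0 if q < 0.
-- It is abstract because unfolding the search makes conversion checking explode.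

abstract
  sqrtSearch : ℚ → ℕ → ℕ → ℚ
  sqrtSearch q n zero = 0ℚ
  sqrtSearch q n (suc k) =
    if ⌊ p * p ℚₚ.≤? q ⌋ then p else sqrtSearch q n k
    where
    p : ℚ
    p = + suc k / suc n

  sqrtApprox : ℚ → ℕ → ℚ
  sqrtApprox q n = sqrtSearch q n (suc ℤ.∣ ℚ.↥ q ∣ ℕ.* suc n)

private
  toℚᵘ-/ : ∀ i n → ℚ.toℚᵘ (i / suc n) ℚᵘ.≃ ℚᵘ.mkℚᵘ i n
  toℚᵘ-/ i n = ℚₚ.toℚᵘ-fromℚᵘ (ℚᵘ.mkℚᵘ i n)

  0<1/ : ∀ k n → 0ℚ < + suc k / suc n
  0<1/ k n = ℚₚ.positive⁻¹ (+ suc k / suc n) {{ℚₚ.normalize-pos (suc k) (suc n)}}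

  /-suc : ∀ k n → + suc k / suc n ≡ + k / suc n + + 1 / suc n
  /-suc k n = ℚₚ.toℚᵘ-injective (begin
    ℚ.toℚᵘ (+ suc k / suc n)                         ≈⟨ toℚᵘ-/ (+ suc k) n ⟩
    ℚᵘ.mkℚᵘ (+ suc k) n                              ≈⟨ ℚᵘ.*≡* eq ⟩
    ℚᵘ.mkℚᵘ (+ k) n ℚᵘ.+ ℚᵘ.mkℚᵘ (+ 1) n             ≈⟨ ℚᵘₚ.+-cong (toℚᵘ-/ (+ k) n) (toℚᵘ-/ (+ 1) n) ⟨
    ℚ.toℚᵘ (+ k / suc n) ℚᵘ.+ ℚ.toℚᵘ (+ 1 / suc n)   ≈⟨ ℚₚ.toℚᵘ-homo-+ (+ k / suc n) (+ 1 / suc n) ⟨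
    ℚ.toℚᵘ (+ k / suc n + + 1 / suc n)               ∎)
    where
    open import Relation.Binary.Reasoning.Setoid ℚᵘₚ.≃-setoid
    open import Data.Integer.Solver using () renaming (module +-*-Solver to ℤSolver)
    open ℤSolver using () renaming (solve to solveℤ; _:+_ to _⊞_; _:*_ to _⊠_; _:=_ to _⊜_; con to conℤ)
    eq : + suc k ℤ.* (+ suc n ℤ.* + suc n) ≡ (+ k ℤ.* + suc n ℤ.+ + 1 ℤ.* + suc n) ℤ.* + suc n
    eq = solveℤ 2 (λ k n → (conℤ (+ 1) ⊞ k) ⊠ (n ⊠ n) ⊜ (k ⊠ n ⊞ conℤ (+ 1) ⊠ n) ⊠ n) refl (+ k) (+ suc n)

  q<1+∣q∣ : ∀ q → q < + suc ℤ.∣ ℚ.↥ q ∣ / 1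
  q<1+∣q∣ q@(ℚ.mkℚ i d _) = ℚₚ.toℚᵘ-cancel-< (ℚᵘₚ.<-respʳ-≃
    (ℚᵘₚ.≃-sym (toℚᵘ-/ (+ suc ℤ.∣ i ∣) 0)) (ℚᵘ.*<* i*1<))
    where
    i≤∣i∣ : ∀ i → i ℤ.≤ + ℤ.∣ i ∣
    i≤∣i∣ (+ n) = ℤₚ.≤-refl
    i≤∣i∣ (ℤ.-[1+ n ]) = ℤ.-≤+
    i*1< : i ℤ.* + 1 ℤ.< + suc ℤ.∣ i ∣ ℤ.* + suc d
    i*1< = subst (ℤ._< + suc ℤ.∣ i ∣ ℤ.* + suc d) (sym (ℤₚ.*-identityʳ i)) (ℤₚ.≤-<-trans (i≤∣i∣ i)
      (subst (+ ℤ.∣ i ∣ ℤ.<_) (ℤₚ.pos-* (suc ℤ.∣ i ∣) (suc d))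
        (ℤ.+<+ (ℕₚ.m≤m*n (suc ℤ.∣ i ∣) (suc d)))))

  /-cancel : ∀ k n → + (k ℕ.* suc n) / suc n ≡ + k / 1
  /-cancel k n = ℚₚ.toℚᵘ-injective (begin
    ℚ.toℚᵘ (+ (k ℕ.* suc n) / suc n)   ≈⟨ toℚᵘ-/ (+ (k ℕ.* suc n)) n ⟩
    ℚᵘ.mkℚᵘ (+ (k ℕ.* suc n)) n        ≈⟨ ℚᵘ.*≡* (trans (ℤₚ.*-identityʳ _) (ℤₚ.pos-* k (suc n))) ⟩
    ℚᵘ.mkℚᵘ (+ k) 0                    ≈⟨ toℚᵘ-/ (+ k) 0 ⟨
    ℚ.toℚᵘ (+ k / 1)                   ∎)
    where open import Relation.Binary.Reasoning.Setoid ℚᵘₚ.≃-setoid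

  1≤/1 : ∀ k → 1ℚ ≤ + suc k / 1
  1≤/1 k = subst₂ _≤_ (ℚₚ.+-identityˡ 1ℚ) (sym (/-suc k 0))
    (ℚₚ.+-monoˡ-≤ 1ℚ (ℚₚ.nonNegative⁻¹ (+ k / 1) {{ℚₚ.normalize-nonNeg k 1}}))

  1/suc<ε : ∀ ε → 0ℚ < ε → ∃ λ N → ∀ n → N ℕ.≤ n → + 1 / suc n < ε
  1/suc<ε (ℚ.mkℚ (+ suc p) d _) _ = suc d , λ n h → ℚₚ.toℚᵘ-cancel-<
    (ℚᵘₚ.<-respˡ-≃ (ℚᵘₚ.≃-sym (toℚᵘ-/ (+ 1) n))
      (ℚᵘ.*<* (ℤ.+<+ (ℕₚ.≤-<-trans (ℕₚ.≤-reflexive (ℕₚ.*-identityˡ (suc d)))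
        (ℕₚ.<-≤-trans (ℕ.s≤s h) (ℕₚ.m≤n*m (suc n) (suc p)))))))
  1/suc<ε (ℚ.mkℚ (+ zero) d _) (ℚ.*<* (ℤ.+<+ ()))
  1/suc<ε (ℚ.mkℚ ℤ.-[1+ p ] d _) (ℚ.*<* ())

  ⊔0-< : ∀ {p r} → p < r → 0ℚ < r → p ⊔ 0ℚ < r
  ⊔0-< {p} p<r 0<r with ℚₚ.⊔-sel p 0ℚ
  ... | inj₁ eq = subst (_< _) (sym eq) p<r
  ... | inj₂ eq = subst (_< _) (sym eq) 0<r

  0≤⊔0 : ∀ p → 0ℚ ≤ p ⊔ 0ℚ
  0≤⊔0 p = ℚₚ.p≤q⊔p p 0ℚ

  ⊔0-close : ∀ p q {ε} → 0ℚ < ε → p < q + ε → p ⊔ 0ℚ < q ⊔ 0ℚ + ε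
  ⊔0-close p q {ε} 0<ε p<q+ε = ⊔0-<
    (ℚₚ.<-≤-trans p<q+ε (ℚₚ.+-monoˡ-≤ ε (ℚₚ.p≤p⊔q q 0ℚ)))
    (ℚₚ.+-mono-≤-< (0≤⊔0 q) 0<ε)

SqrtSpec : ℚ → ℕ → ℚ → Set
SqrtSpec q n r = 0ℚ ≤ r × r * r ≤ q ⊔ 0ℚ × q ⊔ 0ℚ < (r + + 1 / suc n) * (r + + 1 / suc n)

abstract
  sqrtSearch-spec : ∀ q n k → q ⊔ 0ℚ < (+ suc k / suc n) * (+ suc k / suc n) →
                    SqrtSpec q n (sqrtSearch q n k)
  sqrtSearch-spec q n zero h = ℚₚ.≤-refl , 0≤⊔0 q ,
    subst (λ d → q ⊔ 0ℚ < d * d) (sym (ℚₚ.+-identityˡ (+ 1 / suc n))) h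
  sqrtSearch-spec q n (suc k) h = go (p * p ℚₚ.≤? q)
    where
    p : ℚ
    p = + suc k / suc n
    go : (d : Dec (p * p ≤ q)) → SqrtSpec q n (if ⌊ d ⌋ then p else sqrtSearch q n k)
    go (yes p²≤q) = ℚₚ.<⇒≤ (0<1/ k n) , ℚₚ.≤-trans p²≤q (ℚₚ.p≤p⊔q q 0ℚ) ,
      subst (λ d → q ⊔ 0ℚ < d * d) (/-suc (suc k) n) h
    go (no  p²≰q) = sqrtSearch-spec q n k (⊔0-< (ℚₚ.≰⇒> p²≰q) (0<* (0<1/ k n) (0<1/ k n)))

  sqrtApprox-spec : ∀ q n → SqrtSpec q n (sqrtApprox q n)
  sqrtApprox-spec q n = sqrtSearch-spec q n (c ℕ.* suc n) (begin-strict
    q ⊔ 0ℚ                                  <⟨ ⊔0-< (q<1+∣q∣ q) (0<1/ ℤ.∣ ℚ.↥ q ∣ 0) ⟩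
    C                                       ≡⟨ sym (ℚₚ.*-identityʳ C) ⟩
    C * 1ℚ                                  ≤⟨ *-mono-≤ 0≤C 0≤C ℚₚ.≤-refl (1≤/1 ℤ.∣ ℚ.↥ q ∣) ⟩
    C * C                                   ≤⟨ *-mono-≤ 0≤C (ℚₚ.≤-trans 0≤C C≤D) C≤D C≤D ⟩
    D * D                                   ∎)
    where
    open ≤-Reasoning
    c : ℕ
    c = suc ℤ.∣ ℚ.↥ q ∣
    C D : ℚ
    C = + c / 1
    D = + suc (c ℕ.* suc n) / suc n
    0≤C : 0ℚ ≤ C
    0≤C = ℚₚ.<⇒≤ (0<1/ ℤ.∣ ℚ.↥ q ∣ 0)
    C≤D : C ≤ D
    C≤D = subst₂ _≤_ (trans (ℚₚ.+-identityʳ _) (/-cancel c n)) (sym (/-suc (c ℕ.* suc n) n))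
      (ℚₚ.+-monoʳ-≤ (+ (c ℕ.* suc n) / suc n) (ℚₚ.<⇒≤ (0<1/ 0 n)))

private
  sqrt-close : ∀ {a b r s δ ε} → 0ℚ ≤ r → 0ℚ ≤ s → 0ℚ ≤ δ → 0ℚ < ε → δ < ε →
               r * r ≤ a → b < (s + δ) * (s + δ) → a < b + ε * ε → r < s + (ε + ε)
  sqrt-close {a} {b} {r} {s} {δ} {ε} 0≤r 0≤s 0≤δ 0<ε δ<ε r²≤a b< a<
    with r ℚₚ.<? s + (ε + ε)
  ... | yes r< = r<
  ... | no  r≮ = contradiction (begin-strict
    r * r                                            ≤⟨ r²≤a ⟩
    a                                                <⟨ a< ⟩
    b + ε * ε                                        <⟨ ℚₚ.+-monoˡ-< (ε * ε) b< ⟩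
    (s + δ) * (s + δ) + ε * ε                        ≤⟨ ℚₚ.+-monoˡ-≤ (ε * ε) (*-mono-≤ (ℚₚ.+-mono-≤ 0≤s 0≤δ) 0≤s+ε s+δ≤s+ε s+δ≤s+ε) ⟩
    (s + ε) * (s + ε) + ε * ε                        ≡⟨ sym (ℚₚ.+-identityʳ _) ⟩
    (s + ε) * (s + ε) + ε * ε + 0ℚ                   ≤⟨ ℚₚ.+-monoʳ-≤ ((s + ε) * (s + ε) + ε * ε) (*-mono-≤ {0ℚ} {s + ε} {0ℚ} {ε + ε} ℚₚ.≤-refl 0≤2ε 0≤s+ε 0≤2ε) ⟩
    (s + ε) * (s + ε) + ε * ε + (s + ε) * (ε + ε)    ≡⟨ solve 2 (λ s ε → (s :+ ε) :* (s :+ ε) :+ ε :* ε :+ (s :+ ε) :* (ε :+ ε) := (s :+ (ε :+ ε)) :* (s :+ (ε :+ ε))) refl s ε ⟩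
    (s + (ε + ε)) * (s + (ε + ε))                    ≤⟨ *-mono-≤ (ℚₚ.+-mono-≤ 0≤s 0≤2ε) 0≤r (ℚₚ.≮⇒≥ r≮) (ℚₚ.≮⇒≥ r≮) ⟩
    r * r                                            ∎)
    (ℚₚ.<-irrefl refl)
    where
    open ≤-Reasoning
    0≤2ε : 0ℚ ≤ ε + ε
    0≤2ε = ℚₚ.<⇒≤ (0<+ 0<ε 0<ε)
    0≤s+ε : 0ℚ ≤ s + ε
    0≤s+ε = ℚₚ.+-mono-≤ 0≤s (ℚₚ.<⇒≤ 0<ε)
    s+δ≤s+ε : s + δ ≤ s + ε
    s+δ≤s+ε = ℚₚ.+-monoʳ-≤ s (ℚₚ.<⇒≤ δ<ε)

  sqrtApprox-close : ∀ {p q m n ε} → 0ℚ < ε → + 1 / suc m < ε → + 1 / suc n < ε →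
                     ∣ p - q ∣ < ε * ε → ∣ sqrtApprox p m - sqrtApprox q n ∣ < ε + ε
  sqrtApprox-close {p} {q} {m} {n} {ε} 0<ε δm δn h =
    let (0≤r , r²≤ , <r) = sqrtApprox-spec p m
        (0≤s , s²≤ , <s) = sqrtApprox-spec q n
    in within (sqrtApprox p m) (sqrtApprox q n)
      (sqrt-close 0≤r 0≤s (ℚₚ.<⇒≤ (0<1/ 0 n)) 0<ε δn r²≤ <s
        (⊔0-close p q (0<* 0<ε 0<ε) (∣p-q∣<ε⇒p<q+ε p q h)))
      (sqrt-close 0≤s 0≤r (ℚₚ.<⇒≤ (0<1/ 0 m)) 0<ε δm s²≤ <r
        (⊔0-close q p (0<* 0<ε 0<ε) (∣p-q∣<ε⇒p<q+ε q p (subst (_< ε * ε) (∣p-q∣≡∣q-p∣ p q) h))))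

abstract
  √-isCauchy : ∀ x → IsCauchy (λ n → sqrtApprox (seq x n) n)
  √-isCauchy x ε 0<ε = let 0<η = 0<* 0<½ 0<ε in eventually₂
    (λ m n p (δm , δn) → subst (∣ sqrtApprox (seq x m) m - sqrtApprox (seq x n) n ∣ <_) (½+½ ε)
      (sqrtApprox-close {seq x m} {seq x n} {m} {n} 0<η δm δn p))
    (cauchy x (½ * ε * (½ * ε)) (0<* 0<η 0<η))
    (map₂ (λ δ< m n hm hn → δ< m hm , δ< n hn) (1/suc<ε (½ * ε) 0<η))

√_ : ℝ → ℝ
√ x = mkℝ (λ n → sqrtApprox (seq x n) n) (√-isCauchy x)

NonNegᴿ : ℝ → Set
NonNegᴿ x = ∀ ε → 0ℚ < ε → ∃ λ N → ∀ n → N ℕ.≤ n → 0ℚ < seq x n + ε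

abstract
  √-nonNeg : ∀ x → NonNegᴿ (√ x)
  √-nonNeg x ε 0<ε = 0 , λ n _ → ℚₚ.+-mono-≤-< (proj₁ (sqrtApprox-spec (seq x n) n)) 0<ε

  √-cong : ∀ {x y} → x ≃ y → √ x ≃ √ y
  √-cong {x} {y} h ε 0<ε = let 0<η = 0<* 0<½ 0<ε in eventually
    (λ n (p , q) → subst (∣ sqrtApprox (seq x n) n - sqrtApprox (seq y n) n ∣ <_) (½+½ ε)
      (sqrtApprox-close {seq x n} {seq y n} {n} {n} 0<η
        q q p))
    (h (½ * ε * (½ * ε)) (0<* 0<η 0<η) and 1/suc<ε (½ * ε) 0<η)

  √-square : ∀ {x} → NonNegᴿ x → √ x *ᴿ √ x ≃ x
  √-square {x} 0≤x ε 0<ε =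
    let (B , 0<B , b) = bounded (√ x)
        (η , 0<η , Kη<ε) = divide {B + B + 1ℚ} (0<+ (0<+ 0<B 0<B) 0<1) 0<ε
    in eventually
      (λ n ((r<B , 0<x+ε) , (δ<η , δ<1)) →
        bound (seq x n) n 0<η Kη<ε r<B 0<x+ε δ<η δ<1)
      ((b and 0≤x ε 0<ε) and (1/suc<ε η 0<η and 1/suc<ε 1ℚ 0<1))
    where
    0<1 : 0ℚ < 1ℚ
    0<1 = ℚₚ.positive⁻¹ 1ℚ

    bound : ∀ q n {B η} → 0ℚ < η → (B + B + 1ℚ) * η < ε → ∣ sqrtApprox q n ∣ < B →
            0ℚ < q + ε → + 1 / suc n < η → + 1 / suc n < 1ℚ →
            ∣ sqrtApprox q n * sqrtApprox q n - q ∣ < ε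
    bound q n {B} {η} 0<η Kη<ε ∣r∣<B 0<q+ε δ<η δ<1 = within (r * r) q
      (ℚₚ.≤-<-trans (proj₁ (proj₂ spec))
        (⊔0-< (subst (_< q + ε) (ℚₚ.+-identityʳ q) (ℚₚ.+-monoʳ-< q 0<ε)) 0<q+ε))
      (begin-strict
        q                             ≤⟨ ℚₚ.p≤p⊔q q 0ℚ ⟩
        q ⊔ 0ℚ                        <⟨ proj₂ (proj₂ spec) ⟩
        (r + δ) * (r + δ)             ≡⟨ solve 2 (λ r δ → (r :+ δ) :* (r :+ δ) := r :* r :+ (r :+ r :+ δ) :* δ) refl r δ ⟩
        r * r + (r + r + δ) * δ       ≤⟨ ℚₚ.+-monoʳ-≤ (r * r) (*-mono-≤ 0≤r+r+δ (ℚₚ.<⇒≤ 0<η) (ℚₚ.+-mono-≤ (ℚₚ.+-mono-≤ r≤B r≤B) (ℚₚ.<⇒≤ δ<1)) (ℚₚ.<⇒≤ δ<η)) ⟩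
        r * r + (B + B + 1ℚ) * η      <⟨ ℚₚ.+-monoʳ-< (r * r) Kη<ε ⟩
        r * r + ε                     ∎)
      where
      open ≤-Reasoning
      r δ : ℚ
      r = sqrtApprox q n
      δ = + 1 / suc n
      spec : SqrtSpec q n r
      spec = sqrtApprox-spec q n
      0≤r : 0ℚ ≤ r
      0≤r = proj₁ spec
      0≤r+r+δ : 0ℚ ≤ r + r + δ
      0≤r+r+δ = ℚₚ.+-mono-≤ (ℚₚ.+-mono-≤ 0≤r 0≤r) (ℚₚ.<⇒≤ (0<1/ 0 n))
      r≤B : r ≤ B
      r≤B = ℚₚ.<⇒≤ (ℚₚ.≤-<-trans (p≤∣p∣ r) ∣r∣<B)

private
  module R = CommutativeRing ℝ-commutativeRing

open import Algebra.Properties.Semiring.Sum R.semiring using (sum)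

ℝ^ : ℕ → LeftModule R.ring 0ℓ 0ℓ
ℝ^ n = record
  { Carrierᴹ = Vector ℝ n
  ; _≈ᴹ_ = λ x y → ∀ i → x i ≃ y i
  ; _+ᴹ_ = λ x y i → x i +ᴿ y i
  ; _*ₗ_ = λ c x i → c *ᴿ x i
  ; 0ᴹ = λ _ → R.0#
  ; -ᴹ_ = λ x i → -ᴿ x i
  ; isLeftModule = record
    { isLeftSemimodule = record
      { +ᴹ-isCommutativeMonoid = record
        { isMonoid = record
          { isSemigroup = record
            { isMagma = record
              { isEquivalence = record
                { refl = λ {x} i → R.refl {x i}
                ; sym = λ {x} {y} p i → R.sym {x i} {y i} (p i)
                ; trans = λ {x} {y} {z} p q i → R.trans {x i} {y i} {z i} (p i) (q i)
                }
              ; ∙-cong = λ {x} {x′} {y} {y′} p q i → R.+-cong {x i} {x′ i} {y i} {y′ i} (p i) (q i)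
              }
            ; assoc = λ x y z i → R.+-assoc (x i) (y i) (z i)
            }
          ; identity = (λ x i → R.+-identityˡ (x i)) , (λ x i → R.+-identityʳ (x i))
          }
        ; comm = λ x y i → R.+-comm (x i) (y i)
        }
      ; isPreleftSemimodule = record
        { *ₗ-cong = λ {c} {d} {x} {y} p q i → R.*-cong {c} {d} {x i} {y i} p (q i)
        ; *ₗ-zeroˡ = λ x i → R.zeroˡ (x i)
        ; *ₗ-distribʳ = λ x c d i → R.distribʳ (x i) c d
        ; *ₗ-identityˡ = λ x i → R.*-identityˡ (x i)
        ; *ₗ-assoc = λ c d x i → R.*-assoc c d (x i)
        ; *ₗ-zeroʳ = λ c i → R.zeroʳ c
        ; *ₗ-distribˡ = λ c x y i → R.distribˡ c (x i) (y i)
        }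
      }
    ; -ᴹ‿cong = λ {x} {y} p i → R.-‿cong {x i} {y i} (p i)
    ; -ᴹ‿inverse = (λ x i → R.-‿inverseˡ (x i)) , (λ x i → R.-‿inverseʳ (x i))
    }
  }

infix 4 _≈ᵛ_

_≈ᵛ_ : ∀ {n} → Rel (Vector ℝ n) 0ℓ
_≈ᵛ_ {n} = LeftModule._≈ᴹ_ (ℝ^ n)

0ᵛ : ∀ {n} → Vector ℝ n
0ᵛ {n} = LeftModule.0ᴹ (ℝ^ n)

∥_∥ : ∀ {n} → Vector ℝ n → ℝ
∥ x ∥ = √ sum (λ i → x i *ᴿ x i)

IsLinear : ∀ {m n} → (Vector ℝ m → Vector ℝ n) → Set
IsLinear {m} {n} = IsLeftModuleHomomorphism
  where open LeftModuleMorphisms (LeftModule.rawLeftModule (ℝ^ m)) (LeftModule.rawLeftModule (ℝ^ n))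

linearCombination : ∀ {n k} → Vector ℝ k → Vector (Vector ℝ n) k → Vector ℝ n
linearCombination c v i = sum (λ j → c j *ᴿ v j i)

record Subspace (n : ℕ) : Set₁ where
  open LeftModule (ℝ^ n) using (_≈ᴹ_; _+ᴹ_; _*ₗ_; 0ᴹ)
  field
    member   : Pred (Vector ℝ n) 0ℓ
    resp     : ∀ {x y : Vector ℝ n} → x ≈ᴹ y → member x → member y
    0-closed : member 0ᴹ
    +-closed : ∀ {x y : Vector ℝ n} → member x → member y → member (x +ᴹ y)
    *-closed : ∀ c {x : Vector ℝ n} → member x → member (c *ₗ x)

infix 4 _∈_

_∈_ : ∀ {n} → Vector ℝ n → Subspace n → Set
x ∈ X = Subspace.member X x

record HasDimension {n} (X : Subspace n) (k : ℕ) : Set where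
  field
    basis       : Vector (Vector ℝ n) k
    inside      : ∀ i → basis i ∈ X
    independent : ∀ c → linearCombination c basis ≈ᵛ 0ᵛ → c ≈ᵛ 0ᵛ
    spanning    : ∀ {x} → x ∈ X → ∃ λ c → x ≈ᵛ linearCombination c basis

record LinearIsometryOnto (k : ℕ) {n} (X : Subspace n) : Set where
  field
    map        : Vector ℝ k → Vector ℝ n
    linear     : IsLinear map
    isometric  : ∀ x → ∥ map x ∥ ≃ ∥ x ∥
    inside     : ∀ x → map x ∈ X
    surjective : ∀ {y} → y ∈ X → ∃ λ x → map x ≈ᵛ y

record NormedBilinearMap (r s n : ℕ) : Set where
  field
    map     : Vector ℝ r → Vector ℝ s → Vector ℝ n
    linearˡ : ∀ y → IsLinear (λ x → map x y)
    linearʳ : ∀ x → IsLinear (map x)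
    normed  : ∀ x y → ∥ map x y ∥ ≃ ∥ x ∥ *ᴿ ∥ y ∥

infix 9 _⟨_,_⟩

_⟨_,_⟩ : ∀ {r s n} → NormedBilinearMap r s n → Vector ℝ r → Vector ℝ s → Vector ℝ n
f ⟨ x , y ⟩ = NormedBilinearMap.map f x y

HasIntegerCoefficients : ∀ {r s n} → NormedBilinearMap r s n → Set
HasIntegerCoefficients {r} {s} {n} f =
  ∃ λ (c : Fin n → Fin r → Fin s → ℤ) → ∀ x y k →
    (f ⟨ x , y ⟩) k ≃ sum (λ i → sum (λ j → fromℤ (c k i j) *ᴿ (x i *ᴿ y j)))

-- h ≡ρ[ m ] is the graph of the Hurwitz–Radon function; odd m₀ forces m to be positive.

record _≡ρ[_] (h m : ℕ) : Set where
  field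
    a b m₀ : ℕ
    m₀-odd : ¬ 2 ∣ m₀
    b≤3    : b ℕ.≤ 3
    m≡     : m ≡ 2 ℕ.^ (4 ℕ.* a ℕ.+ b) ℕ.* m₀
    h≡     : h ≡ 8 ℕ.* a ℕ.+ 2 ℕ.^ b

record HurwitzRadonFormula : Set where
  field
    {h m}   : ℕ
    h≡ρ[m]  : h ≡ρ[ m ]
    formula : NormedBilinearMap h m m

record Restriction {h m r s n} (F : NormedBilinearMap h m m) (g : NormedBilinearMap r s n) : Set₁ where
  field
    X     : Subspace h
    Y Z   : Subspace m
    dim-X : HasDimension X r
    dim-Y : HasDimension Y s
    dim-Z : HasDimension Z n
    F⟨X,Y⟩⊆Z : ∀ {x y} → x ∈ X → y ∈ Y → F ⟨ x , y ⟩ ∈ Z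
    α     : LinearIsometryOnto r X
    β     : LinearIsometryOnto s Y
    γ     : LinearIsometryOnto n Z
    γ∘g≈F∘α,β : ∀ x y → LinearIsometryOnto.map γ (g ⟨ x , y ⟩) ≈ᵛ
                        F ⟨ LinearIsometryOnto.map α x , LinearIsometryOnto.map β y ⟩

_IsRestrictionOf_ : ∀ {h m r s n} → NormedBilinearMap r s n → NormedBilinearMap h m m → Set₁
g IsRestrictionOf F = Restriction F g

{-# OPTIONS --safe #-}
module Submission where

-- Put E i = [0, Aᵢᵀ; Aᵢ, 0] on ℝᵐ ⊕ ℝᵐ, where Aᵢ = F⟨α εᵢ , -⟩. Since Aᵢ is square, also Aᵢ Aᵢᵀ = 1, so the
-- E i are ten anticommuting involutions. Integrality means that E i maps yⱼ = (β εⱼ , 0) to ± one of the sixteen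
-- vectors z_k = (0 , γ ε_k), i.e. that a 10 × 10 table M of 16 colours describes g. The words in the E i that fix a
-- given z_k up to sign commute and have square +1: they form a doubly even binary code of length 10. Some colour
-- occurs at least seven times, say on the rows D, and for z_k this colour every yⱼ in question is ± E d z_k with
-- d ∈ D. Any two columns share at least four colours, so any two elements of D lie in a word of length four of the
-- code. Combining such words yields either the code e₇ or the code d₈. With e₇ every column would be one of only
-- eight vectors up to sign; with d₈ seventeen colours would be needed.

open import Algebra.Bundles using (CommutativeRing)
open import Algebra.Module.Morphism.Structures using (module LeftModuleMorphisms)
open import Data.Bool.Base using (Bool; true; false; not; _∧_; _∨_; _xor_; if_then_else_)
open import Data.Bool.ListAction using (any)
open import Data.Bool.Properties using (xor-comm; xor-same)
import Data.Bool.Properties as Bool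
open import Data.Empty using (⊥)
open import Data.Fin.Base as Fin using (Fin; zero; suc; toℕ; inject≤; splitAt; punchIn; punchOut; remQuot; combine)
open import Data.Fin.Patterns
open import Data.Fin.Properties using (_≟_; <⇒≢; all?; any?; combine-remQuot; inject≤-injective; injective⇒≤;
  join-splitAt; pigeonhole; punchIn-injective; punchIn-punchOut; punchInᵢ≢i; toℕ-injective; toℕ<n; ¬∀⟶∃¬)
open import Data.Integer.Base as ℤ using (ℤ; +_; -[1+_])
import Data.Integer.Properties as ℤ
open import Data.List.Base as List using (List; []; _∷_; _++_; map; length; filter; tabulate)
open import Data.List.Membership.Propositional.Properties using (∈-lookup)
open import Data.List.Properties using (length-tabulate; map-++; map-∘)
open import Data.List.Relation.Unary.All as All using (All; []; _∷_)
import Data.List.Relation.Unary.All.Properties as All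
open import Data.List.Relation.Unary.AllPairs using ([]; _∷_)
open import Data.List.Relation.Unary.Unique.Propositional using (Unique)
import Data.List.Relation.Unary.Unique.Propositional.Properties as Unique
open import Data.Nat.Base as ℕ using (ℕ; zero; suc)
import Data.Nat.Properties as ℕ
open import Data.Product.Base using (∃; ∃₂; _×_; _,_; proj₁; proj₂; uncurry)
open import Data.Product.Relation.Binary.Pointwise.NonDependent using (×-setoid)
open import Data.Rational.Base as ℚ using (ℚ; 0ℚ; 1ℚ; _/_; ∣_∣)
import Data.Rational.Properties as ℚ
open import Data.Rational.Solver using (module +-*-Solver)
import Data.Rational.Unnormalised.Base as ℚᵘ
import Data.Rational.Unnormalised.Properties as ℚᵘ
open import Data.Sum.Base using (_⊎_; inj₁; inj₂; [_,_]′)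
open import Data.Vec.Base as Vec using (Vec; []; _∷_)
import Data.Vec.Properties as Vec
open import Data.Vec.Functional as Vector using (Vector)
import Data.Vec.Functional.Relation.Binary.Equality.Setoid as VectorEquality
open import Function.Base using (_∘_; id; case_of_)
open import Function.Definitions using (Injective)
open import Level using (_⊔_)
open import Relation.Binary.Bundles using (Setoid)
open import Relation.Binary.PropositionalEquality as ≡ using (_≡_; _≢_; cong; cong₂; subst)
open import Relation.Nullary using (¬_; Dec; yes; no; does; contradiction)
open import Relation.Nullary.Decidable using (¬?; _×-dec_; _→-dec_; _⊎-dec_; dec-false; from-yes; True; toWitness)
open import Relation.Unary using (Decidable; Pred)
open import Defs

-- Words in anticommuting involutions

-- The code grows by pairs of letters: a tetrad, then two tetrads sharing a pair (a hexad), then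
-- three (an octad, which is d₈). Each enlargement starts from a column whose row lies outside the
-- letters used so far. A hexad uses six of them, which is why one colour has to occur seven times.
-- Each enlargement also leaves a column on its new pair, so the octad comes with three columns,
-- enough cells for the final count of colours. The rows involved are unknown, and a search over
-- whole tables is out of reach. Every finite check is therefore made on labels and transported to
-- the rows by an injective map `ρ`, under which the signs of words survive. The table enters only
-- up to sign. Signs matter only in excluding v = -v, so the combinatorics asks of the vectors just
-- a negation and no addition.

record AnticommutingInvolutions {c ℓ} (W : Setoid c ℓ) (n : ℕ) : Set (c ⊔ ℓ) where
  open Setoid W using (_≈_) renaming (Carrier to V)
  field
    neg            : V → V
    neg-cong       : ∀ {v w} → v ≈ w → neg v ≈ neg w
    neg-involutive : ∀ v → neg (neg v) ≈ v
    E              : Fin n → V → V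
    E-cong         : ∀ i {v w} → v ≈ w → E i v ≈ E i w
    E-neg          : ∀ i v → E i (neg v) ≈ neg (E i v)
    E-involutive   : ∀ i v → E i (E i v) ≈ v
    E-anticommute  : ∀ {i j} → i ≢ j → ∀ v → E i (E j v) ≈ neg (E j (E i v))

-- The parity of the number of letters that differ from `i`: E i commutes with itself and
-- anticommutes with the others.
flips : ∀ {n} → Fin n → List (Fin n) → Bool
flips i []      = false
flips i (j ∷ l) = not (does (i ≟ j)) xor flips i l

flips* : ∀ {n} → List (Fin n) → List (Fin n) → Bool
flips* []      l′ = false
flips* (i ∷ l) l′ = flips i l′ xor flips* l l′

-- Each pair of letters is exchanged once, so k distinct letters give the sign (-1)^(k(k-1)/2).
squareSign : ∀ {n} → List (Fin n) → Bool
squareSign []      = false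
squareSign (i ∷ l) = flips i l xor squareSign l

toggle : ∀ {n} → Fin n → Vec Bool n → Vec Bool n
toggle i v = v Vec.[ i ]%= not

-- The image of a word in F₂ⁿ, which determines its action up to sign by `E*-parity`.
parity : ∀ {n} → List (Fin n) → Vec Bool n
parity {n} []      = Vec.replicate n false
parity     (i ∷ l) = toggle i (parity l)

does-≟-injective : ∀ {m n} {f : Fin m → Fin n} → Injective _≡_ _≡_ f →
                   ∀ i j → does (f i ≟ f j) ≡ does (i ≟ j)
does-≟-injective {f = f} f-inj i j with i ≟ j | f i ≟ f j
... | yes _      | yes _     = ≡.refl
... | yes ≡.refl | no  fi≢fi = contradiction ≡.refl fi≢fi
... | no  i≢j    | yes fi≡fj = contradiction (f-inj fi≡fj) i≢j
... | no  _      | no  _     = ≡.refl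

module _ {m n} {f : Fin m → Fin n} (f-inj : Injective _≡_ _≡_ f) where

  flips-map : ∀ i l → flips (f i) (map f l) ≡ flips i l
  flips-map i []      = ≡.refl
  flips-map i (j ∷ l) = cong₂ _xor_ (cong not (does-≟-injective f-inj i j)) (flips-map i l)

  flips*-map : ∀ l l′ → flips* (map f l) (map f l′) ≡ flips* l l′
  flips*-map []      l′ = ≡.refl
  flips*-map (i ∷ l) l′ = cong₂ _xor_ (flips-map i l′) (flips*-map l l′)

  squareSign-map : ∀ l → squareSign (map f l) ≡ squareSign l
  squareSign-map []      = ≡.refl
  squareSign-map (i ∷ l) = cong₂ _xor_ (flips-map i l) (squareSign-map l)

-- A word that fixes a nonzero vector up to sign has square +1 and commutes with every other such word.
refuted : ∀ {n} → List (List (Fin n)) → List (Fin n) → Bool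
refuted known l = squareSign l ∨ any (flips* l) known

module Words {c ℓ} {W : Setoid c ℓ} {n} (A : AnticommutingInvolutions W n) where
  open Setoid W renaming (Carrier to V)
  open AnticommutingInvolutions A
  open import Relation.Binary.Reasoning.Setoid W

  E* : List (Fin n) → V → V
  E* []      v = v
  E* (i ∷ l) v = E i (E* l v)

  sgn : Bool → V → V
  sgn false v = v
  sgn true  v = neg v

  sgn-cong : ∀ s {v w} → v ≈ w → sgn s v ≈ sgn s w
  sgn-cong false v≈w = v≈w
  sgn-cong true  v≈w = neg-cong v≈w

  sgn-xor : ∀ s t v → sgn s (sgn t v) ≈ sgn (s xor t) v
  sgn-xor false t     v = refl
  sgn-xor true  false v = refl
  sgn-xor true  true  v = neg-involutive v

  E-sgn : ∀ i s v → E i (sgn s v) ≈ sgn s (E i v)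
  E-sgn i false v = refl
  E-sgn i true  v = E-neg i v

  E*-cong : ∀ l {v w} → v ≈ w → E* l v ≈ E* l w
  E*-cong []      v≈w = v≈w
  E*-cong (i ∷ l) v≈w = E-cong i (E*-cong l v≈w)

  E*-sgn : ∀ l s v → E* l (sgn s v) ≈ sgn s (E* l v)
  E*-sgn []      s v = refl
  E*-sgn (i ∷ l) s v = trans (E-cong i (E*-sgn l s v)) (E-sgn i s (E* l v))

  E-swap : ∀ i j v → E i (E j v) ≈ sgn (not (does (i ≟ j))) (E j (E i v))
  E-swap i j v with i ≟ j
  ... | yes ≡.refl = refl
  ... | no  i≢j    = E-anticommute i≢j v

  E-E* : ∀ i l v → E i (E* l v) ≈ sgn (flips i l) (E* l (E i v))
  E-E* i []      v = refl
  E-E* i (j ∷ l) v = begin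
    E i (E j (E* l v))                            ≈⟨ E-swap i j (E* l v) ⟩
    sgn s (E j (E i (E* l v)))                    ≈⟨ sgn-cong s (E-cong j (E-E* i l v)) ⟩
    sgn s (E j (sgn (flips i l) (E* l (E i v))))  ≈⟨ sgn-cong s (E-sgn j (flips i l) _) ⟩
    sgn s (sgn (flips i l) (E j (E* l (E i v))))  ≈⟨ sgn-xor s (flips i l) _ ⟩
    sgn (s xor flips i l) (E j (E* l (E i v)))    ∎
    where
    s : Bool
    s = not (does (i ≟ j))

  E*-comm : ∀ l l′ v → E* l (E* l′ v) ≈ sgn (flips* l l′) (E* l′ (E* l v))
  E*-comm []      l′ v = refl
  E*-comm (i ∷ l) l′ v = begin
    E i (E* l (E* l′ v))                        ≈⟨ E-cong i (E*-comm l l′ v) ⟩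
    E i (sgn t (E* l′ (E* l v)))                ≈⟨ E-sgn i t _ ⟩
    sgn t (E i (E* l′ (E* l v)))                ≈⟨ sgn-cong t (E-E* i l′ (E* l v)) ⟩
    sgn t (sgn (flips i l′) (E* l′ (E i (E* l v))))  ≈⟨ sgn-xor t (flips i l′) _ ⟩
    sgn (t xor flips i l′) (E* l′ (E i (E* l v)))
      ≡⟨ cong (λ s → sgn s (E* l′ (E i (E* l v)))) (xor-comm t (flips i l′)) ⟩
    sgn (flips i l′ xor t) (E* l′ (E i (E* l v)))    ∎
    where
    t : Bool
    t = flips* l l′

  E*-square : ∀ l v → E* l (E* l v) ≈ sgn (squareSign l) v
  E*-square []      v = refl
  E*-square (i ∷ l) v = begin
    E i (E* l (E i (E* l v)))                          ≈⟨ E-E* i l _ ⟩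
    sgn (flips i l) (E* l (E i (E i (E* l v))))        ≈⟨ sgn-cong (flips i l) (E*-cong l (E-involutive i _)) ⟩
    sgn (flips i l) (E* l (E* l v))                    ≈⟨ sgn-cong (flips i l) (E*-square l v) ⟩
    sgn (flips i l) (sgn (squareSign l) v)             ≈⟨ sgn-xor (flips i l) (squareSign l) v ⟩
    sgn (flips i l xor squareSign l) v                 ∎

  infix 4 _∼_

  _∼_ : V → V → Set ℓ
  v ∼ w = ∃ λ s → v ≈ sgn s w

  ≈⇒∼ : ∀ {v w} → v ≈ w → v ∼ w
  ≈⇒∼ v≈w = false , v≈w

  ∼-refl : ∀ {v} → v ∼ v
  ∼-refl = ≈⇒∼ refl

  ∼-sym : ∀ {v w} → v ∼ w → w ∼ v
  ∼-sym (false , v≈w) = false , sym v≈w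
  ∼-sym {w = w} (true , v≈-w) = true , sym (trans (neg-cong v≈-w) (neg-involutive w))

  ∼-trans : ∀ {u v w} → u ∼ v → v ∼ w → u ∼ w
  ∼-trans {w = w} (s , u≈v) (t , v≈w) = s xor t , trans u≈v (trans (sgn-cong s v≈w) (sgn-xor s t w))

  ∼-setoid : Setoid c ℓ
  ∼-setoid = record
    { Carrier = V ; _≈_ = _∼_
    ; isEquivalence = record { refl = ∼-refl ; sym = ∼-sym ; trans = ∼-trans } }

  E-cong-∼ : ∀ i {v w} → v ∼ w → E i v ∼ E i w
  E-cong-∼ i {w = w} (s , v≈w) = s , trans (E-cong i v≈w) (E-sgn i s w)

  E*-cong-∼ : ∀ l {v w} → v ∼ w → E* l v ∼ E* l w
  E*-cong-∼ []      v∼w = v∼w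
  E*-cong-∼ (i ∷ l) v∼w = E-cong-∼ i (E*-cong-∼ l v∼w)

  E-swap-∼ : ∀ i j v → E i (E j v) ∼ E j (E i v)
  E-swap-∼ i j v = not (does (i ≟ j)) , E-swap i j v

  E-transpose : ∀ i {v w} → E i v ∼ w → v ∼ E i w
  E-transpose i {v} Ev∼w = ∼-trans (≈⇒∼ (sym (E-involutive i v))) (E-cong-∼ i Ev∼w)

  E-cancel : ∀ i {v w} → E i v ∼ E i w → v ∼ w
  E-cancel i {w = w} h = ∼-trans (E-transpose i h) (≈⇒∼ (E-involutive i w))

  E*-++ : ∀ l l′ v → E* (l ++ l′) v ≡ E* l (E* l′ v)
  E*-++ []      l′ v = ≡.refl
  E*-++ (i ∷ l) l′ v = cong (E i) (E*-++ l l′ v)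

  Fixes : List (Fin n) → V → Set ℓ
  Fixes l v = E* l v ∼ v

  Fixes-++ : ∀ l l′ {v} → Fixes l v → Fixes l′ v → Fixes (l ++ l′) v
  Fixes-++ l l′ {v} h h′ rewrite E*-++ l l′ v = ∼-trans (E*-cong-∼ l h′) h

  Fixes-resp-∼ : ∀ l {v w} → v ∼ w → Fixes l v → Fixes l w
  Fixes-resp-∼ l v∼w h = ∼-trans (E*-cong-∼ l (∼-sym v∼w)) (∼-trans h v∼w)

  Fixes-E : ∀ i l {v} → Fixes l v → Fixes l (E i v)
  Fixes-E i l {v} h = ∼-trans (∼-sym (flips i l , E-E* i l v)) (E-cong-∼ i h)

  -- Normal form of a word: every label at most once, in increasing order.
  Evec : ∀ {k} → (Fin k → Fin n) → Vec Bool k → V → V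
  Evec f []           v = v
  Evec f (false ∷ bs) v = Evec (f ∘ suc) bs v
  Evec f (true  ∷ bs) v = E (f zero) (Evec (f ∘ suc) bs v)

  E-Evec : ∀ {k} (f : Fin k → Fin n) i bs v → E (f i) (Evec f bs v) ∼ Evec f (toggle i bs) v
  E-Evec f zero    (false ∷ bs) v = ∼-refl
  E-Evec f zero    (true  ∷ bs) v = ≈⇒∼ (E-involutive (f zero) _)
  E-Evec f (suc i) (false ∷ bs) v = E-Evec (f ∘ suc) i bs v
  E-Evec f (suc i) (true  ∷ bs) v =
    ∼-trans (E-swap-∼ (f (suc i)) (f zero) _) (E-cong-∼ (f zero) (E-Evec (f ∘ suc) i bs v))

  Evec-replicate : ∀ {k} (f : Fin k → Fin n) v → Evec f (Vec.replicate k false) v ≡ v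
  Evec-replicate {zero}  f v = ≡.refl
  Evec-replicate {suc k} f v = Evec-replicate (f ∘ suc) v

  E*-Evec : ∀ {k} (f : Fin k → Fin n) l v → E* (map f l) v ∼ Evec f (parity l) v
  E*-Evec f []      v = ≈⇒∼ (reflexive (≡.sym (Evec-replicate f v)))
  E*-Evec f (i ∷ l) v = ∼-trans (E-cong-∼ (f i) (E*-Evec f l v)) (E-Evec f i (parity l) v)

  -- Both words sort to the same `Evec`. Different labels may stand for the same letter, which lets
  -- `quadruple` reorder rows that are not yet known to be distinct.
  E*-parity : ∀ {k} (f : Fin k → Fin n) l l′ → parity l ≡ parity l′ →
              ∀ v → E* (map f l) v ∼ E* (map f l′) v
  E*-parity f l l′ eq v = ∼-trans (E*-Evec f l v)
    (≡.subst (λ bs → Evec f bs v ∼ E* (map f l′) v) (≡.sym eq) (∼-sym (E*-Evec f l′ v)))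

  Fixes-parity : ∀ {k} (f : Fin k → Fin n) l l′ → parity l ≡ parity l′ →
                 ∀ {v} → Fixes (map f l) v → Fixes (map f l′) v
  Fixes-parity f l l′ eq {v} h = ∼-trans (E*-parity f l′ l (≡.sym eq) v) h

  -- A word is its own inverse up to sign, so `l` can be moved to the other side.
  agree⇒Fixes : ∀ l l′ {v} → E* l v ∼ E* l′ v → Fixes (l ++ l′) v
  agree⇒Fixes l l′ {v} h rewrite E*-++ l l′ v =
    ∼-trans (E*-cong-∼ l (∼-sym h)) (squareSign l , E*-square l v)

  -- There is no zero vector at this level of generality; v = -v replaces v = 0.
  Nonzero : V → Set ℓ
  Nonzero v = ¬ v ≈ neg v

  module _ {v} (v≢0 : Nonzero v) where

    sgn-trivial : ∀ s → v ≈ sgn s v → s ≡ false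
    sgn-trivial false _   = ≡.refl
    sgn-trivial true  v≈ = contradiction v≈ v≢0

    -- The vector is a common eigenvector, so both orders act on it by the same scalar;
    -- anticommuting words would give v = -v.
    Fixes⇒flips* : ∀ l l′ → Fixes l v → Fixes l′ v → flips* l l′ ≡ false
    Fixes⇒flips* l l′ (s , h) (t , h′) = sgn-trivial f (begin
      v                               ≡⟨ cong (λ b → sgn b v) (≡.sym (xor-same q)) ⟩
      sgn (q xor q) v                 ≈⟨ sgn-xor q q v ⟨
      sgn q (sgn q v)                 ≈⟨ sgn-cong q (begin
        sgn q v                         ≡⟨ cong (λ b → sgn b v) (xor-comm s t) ⟩
        sgn (t xor s) v                 ≈⟨ product l s l′ t h h′ ⟨
        E* l (E* l′ v)                  ≈⟨ E*-comm l l′ v ⟩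
        sgn f (E* l′ (E* l v))          ≈⟨ sgn-cong f (product l′ t l s h′ h) ⟩
        sgn f (sgn q v)                 ≈⟨ sgn-xor f q v ⟩
        sgn (f xor q) v                 ∎) ⟩
      sgn q (sgn (f xor q) v)         ≈⟨ sgn-xor q (f xor q) v ⟩
      sgn (q xor (f xor q)) v         ≡⟨ cong (λ b → sgn b v) (conj q f) ⟩
      sgn f v                         ∎)
      where
      f q : Bool
      f = flips* l l′
      q = s xor t
      product : ∀ l s l′ t → E* l v ≈ sgn s v → E* l′ v ≈ sgn t v → E* l (E* l′ v) ≈ sgn (t xor s) v
      product l s l′ t h h′ = trans (E*-cong l h′) (trans (E*-sgn l t v) (trans (sgn-cong t h) (sgn-xor t s v)))
      conj : ∀ q f → q xor (f xor q) ≡ f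
      conj false false = ≡.refl
      conj false true  = ≡.refl
      conj true  false = ≡.refl
      conj true  true  = ≡.refl

    -- The eigenvalue is 1 or -1, and its square is 1.
    Fixes⇒squareSign : ∀ l → Fixes l v → squareSign l ≡ false
    Fixes⇒squareSign l (s , h) = sgn-trivial (squareSign l) (begin
      v                        ≡⟨ cong (λ b → sgn b v) (≡.sym (xor-same s)) ⟩
      sgn (s xor s) v          ≈⟨ sgn-xor s s v ⟨
      sgn s (sgn s v)          ≈⟨ sgn-cong s h ⟨
      sgn s (E* l v)           ≈⟨ E*-sgn l s v ⟨
      E* l (sgn s v)           ≈⟨ E*-cong l h ⟨
      E* l (E* l v)            ≈⟨ E*-square l v ⟩
      sgn (squareSign l) v     ∎)

    -- For distinct letters the word of length two squares to -1.
    Fixes-pair : ∀ i j → Fixes (i ∷ j ∷ []) v → i ≡ j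
    Fixes-pair i j h with i ≟ j | Fixes⇒squareSign (i ∷ j ∷ []) h
    ... | yes i≡j | _  = i≡j
    ... | no  _   | ()

    -- An injective relabelling preserves the signs of words, so the test is evaluated on concrete
    -- labels instead of on the unknown rows.
    Fixes⇒¬refuted : ∀ {k} {ρ : Fin k → Fin n} → Injective _≡_ _≡_ ρ → ∀ {known} l →
                     All (λ l′ → Fixes (map ρ l′) v) known → Fixes (map ρ l) v →
                     refuted known l ≡ false
    Fixes⇒¬refuted {ρ = ρ} ρ-inj {known} l hs h = cong₂ _∨_
      (≡.trans (≡.sym (squareSign-map ρ-inj l)) (Fixes⇒squareSign (map ρ l) h))
      (commuting hs)
      where
      commuting : ∀ {known} → All (λ l′ → Fixes (map ρ l′) v) known → any (flips* l) known ≡ false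
      commuting []                      = ≡.refl
      commuting (_∷_ {x = l′} h′ hs) = cong₂ _∨_
        (≡.trans (≡.sym (flips*-map ρ-inj l l′)) (Fixes⇒flips* (map ρ l) (map ρ l′) h h′))
        (commuting hs)

  Nonzero-E : ∀ i {v w} → E i v ∼ w → Nonzero w → Nonzero v
  Nonzero-E i {v} {w} (s , Ev≈) w≢0 v≈-v = w≢0 (begin
    w                     ≈⟨ fixed ⟨
    sgn s (E i v)         ≈⟨ sgn-cong s (trans (E-cong i v≈-v) (E-neg i v)) ⟩
    sgn s (neg (E i v))
      ≈⟨ trans (sgn-xor s true _) (trans (reflexive (cong (λ b → sgn b (E i v)) (xor-comm s true))) (sym (sgn-xor true s _))) ⟩
    neg (sgn s (E i v))   ≈⟨ neg-cong fixed ⟩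
    neg w                 ∎)
    where
    fixed : sgn s (E i v) ≈ w
    fixed = trans (sgn-cong s Ev≈) (trans (sgn-xor s s w) (reflexive (cong (λ b → sgn b w) (xor-same s))))

-- Pigeonhole principles

length-filter-split : ∀ {a p} {A : Set a} {P : Pred A p} (P? : Decidable P) xs →
                      length (filter P? xs) ℕ.+ length (filter (¬? ∘ P?) xs) ≡ length xs
length-filter-split P? []       = ≡.refl
length-filter-split P? (x ∷ xs) with does (P? x)
... | true  = cong suc (length-filter-split P? xs)
... | false = ≡.trans (ℕ.+-suc _ _) (cong suc (length-filter-split P? xs))

lookup-injective : ∀ {a} {A : Set a} {xs : List A} → Unique xs → Injective _≡_ _≡_ (List.lookup xs)
lookup-injective {xs = x ∷ xs} (x∉ ∷ u) {zero}  {zero}  eq = ≡.refl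
lookup-injective {xs = x ∷ xs} (x∉ ∷ u) {zero}  {suc j} eq = contradiction eq (All.lookup x∉ (∈-lookup j))
lookup-injective {xs = x ∷ xs} (x∉ ∷ u) {suc i} {zero}  eq = contradiction (≡.sym eq) (All.lookup x∉ (∈-lookup i))
lookup-injective {xs = x ∷ xs} (x∉ ∷ u) {suc i} {suc j} eq = cong suc (lookup-injective u eq)

-- If the last colour is used at most k times, discarding its elements leaves enough of them for the
-- remaining colours.
largeFibre-list : ∀ {a} {A : Set a} m k (f : A → ℕ) xs → Unique xs → All (λ x → f x ℕ.< m) xs →
                  m ℕ.* k ℕ.< length xs → ∃₂ λ c ys → Unique ys × All (λ y → f y ≡ c) ys × k ℕ.< length ys
largeFibre-list zero    k f (x ∷ xs) u (() ∷ _) h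
largeFibre-list (suc m) k f xs u f< h with k ℕ.<? length (filter (λ x → f x ℕ.≟ m) xs)
... | yes k< = m , _ , Unique.filter⁺ (λ x → f x ℕ.≟ m) u , All.all-filter (λ x → f x ℕ.≟ m) xs , k<
... | no  k≮ = largeFibre-list m k f (filter (¬? ∘ P?) xs) (Unique.filter⁺ (¬? ∘ P?) u)
    (All.zipWith (λ (fx<1+m , fx≢m) → ℕ.≤∧≢⇒< (ℕ.≤-pred fx<1+m) fx≢m)
      (All.filter⁺ (¬? ∘ P?) f< , All.all-filter (¬? ∘ P?) xs))
    (ℕ.+-cancelˡ-< k _ _ (ℕ.<-≤-trans h (ℕ.≤-trans (ℕ.≤-reflexive (≡.sym (length-filter-split P? xs)))
      (ℕ.+-monoˡ-≤ _ (ℕ.≮⇒≥ k≮)))))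
  where
  P? : ∀ x → Dec (f x ≡ m)
  P? x = f x ℕ.≟ m

largeFibre : ∀ {m k n} (f : Fin n → Fin m) → m ℕ.* k ℕ.< n →
             ∃₂ λ c (g : Fin (suc k) → Fin n) → Injective _≡_ _≡_ g × (∀ i → f (g i) ≡ c)
largeFibre {m} {k} {n} f mk<n
  with _ , ys , unique , constant , k<∣ys∣ ← largeFibre-list m k (toℕ ∘ f) (tabulate {n = n} id)
         (Unique.tabulate⁺ id) (All.tabulate⁺ λ i → toℕ<n (f i))
         (subst (m ℕ.* k ℕ.<_) (≡.sym (length-tabulate {n = n} id)) mk<n)
  = f (g zero) , g , (λ eq → inject≤-injective _ _ _ _ (lookup-injective unique eq)) ,
    λ i → toℕ-injective (≡.trans (All.lookup constant (∈-lookup _)) (≡.sym (All.lookup constant (∈-lookup _))))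
  where
  g : Fin (suc k) → Fin n
  g i = List.lookup ys (inject≤ i k<∣ys∣)

Missing : ∀ {m n} → (Fin m → Fin n) → Fin n → Set
Missing ρ a = ∀ i → a ≢ ρ i

missing : ∀ {k m n} (ρ : Fin m → Fin n) {d : Fin k → Fin n} → Injective _≡_ _≡_ d → m ℕ.< k →
          ∃ λ s → Missing ρ (d s)
missing ρ {d} d-inj m<k with all? (λ s → any? (λ i → d s ≟ ρ i))
... | yes d⊆ρ with i , j , i<j , eq ← pigeonhole m<k (proj₁ ∘ d⊆ρ) =
  contradiction (d-inj (≡.trans (proj₂ (d⊆ρ i)) (≡.trans (cong ρ eq) (≡.sym (proj₂ (d⊆ρ j)))))) (<⇒≢ i<j)
... | no  d⊈ρ with s , ds∉ρ ← ¬∀⟶∃¬ _ _ (λ s → any? (λ i → d s ≟ ρ i)) d⊈ρ = s , λ i eq → ds∉ρ (i , eq)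

∷-injective : ∀ {m n} {a : Fin n} {ρ : Fin m → Fin n} → Missing ρ a → Injective _≡_ _≡_ ρ →
              Injective _≡_ _≡_ (a Vector.∷ ρ)
∷-injective a∉ρ ρ-inj {zero}  {zero}  eq = ≡.refl
∷-injective a∉ρ ρ-inj {zero}  {suc j} eq = contradiction eq (a∉ρ j)
∷-injective a∉ρ ρ-inj {suc i} {zero}  eq = contradiction (≡.sym eq) (a∉ρ i)
∷-injective a∉ρ ρ-inj {suc i} {suc j} eq = cong suc (ρ-inj eq)

injective? : ∀ {m n} (f : Fin m → Fin n) → Dec (∀ i j → f i ≡ f j → i ≡ j)
injective? f = all? λ i → all? λ j → (f i ≟ f j) →-dec (i ≟ j)

-- A missed value, prepended to `f`, would give an injection of n + 1 elements into n.
surjective : ∀ {n} {f : Fin n → Fin n} → Injective _≡_ _≡_ f → ∀ a → ∃ λ i → f i ≡ a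
surjective {n} {f} f-inj a with any? (λ i → f i ≟ a)
... | yes hit = hit
... | no  a∉f = contradiction (injective⇒≤ (∷-injective (λ i eq → a∉f (i , ≡.sym eq)) f-inj)) ℕ.1+n≰n

-- Finite checks on doubly even codes

_≟ᵛ_ : ∀ {n} (u v : Vec Bool n) → Dec (u ≡ v)
_≟ᵛ_ = Vec.≡-dec Bool._≟_

Relabels : ∀ {m n} → List (Fin n) → (Fin m → Fin n) → List (Fin m) → Set
Relabels l π l′ = parity l ≡ parity (map π l′)

relabels? : ∀ {m n} l (π : Fin m → Fin n) l′ → Dec (Relabels l π l′)
relabels? l π l′ = parity l ≟ᵛ parity (map π l′)

-- With labels read as binary vectors, heptad₁, heptad₂ and heptad₃ generate the code e₇ of all words of even
-- length and sum zero, and heptadClass lists a word of length two or zero for each of the eight sums.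
heptad₁ heptad₂ heptad₃ : List (Fin 7)
heptad₁ = 0F ∷ 1F ∷ 2F ∷ 3F ∷ []
heptad₂ = 0F ∷ 1F ∷ 4F ∷ 5F ∷ []
heptad₃ = 0F ∷ 2F ∷ 4F ∷ 6F ∷ []

heptadWord : Fin 8 → List (Fin 7)
heptadWord = Vec.lookup
  ( [] ∷ heptad₁ ∷ heptad₂ ∷ heptad₃ ∷ (heptad₁ ++ heptad₂) ∷ (heptad₁ ++ heptad₃) ∷ (heptad₂ ++ heptad₃)
  ∷ (heptad₁ ++ heptad₂ ++ heptad₃) ∷ [])

heptadClass : Fin 8 → List (Fin 7)
heptadClass = Vec.lookup
  ( [] ∷ (0F ∷ 1F ∷ []) ∷ (0F ∷ 2F ∷ []) ∷ (0F ∷ 3F ∷ []) ∷ (0F ∷ 4F ∷ [])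
  ∷ (0F ∷ 5F ∷ []) ∷ (0F ∷ 6F ∷ []) ∷ (1F ∷ 6F ∷ []) ∷ [])

-- The finite searches are abstract so that conversion checking does not unfold them.
abstract
  -- The even words on seven letters fall into 2^6 / 2^3 = 8 classes modulo e₇, each with a
  -- representative in `heptadClass`.
  heptad-classes : ∀ x x′ → ∃₂ λ h s → parity (x ∷ x′ ∷ []) ≡ parity (heptadClass h ++ heptadWord s)
  heptad-classes = from-yes (all? λ x → all? λ x′ → any? λ h → any? λ s →
    parity (x ∷ x′ ∷ []) ≟ᵛ parity (heptadClass h ++ heptadWord s))

-- The labels 0, 1, 2 are left to the three rows outside the heptad.
heptadWords : List (List (Fin 10))
heptadWords = (3F ∷ 4F ∷ 5F ∷ 6F ∷ []) ∷ (3F ∷ 4F ∷ 7F ∷ 8F ∷ []) ∷ (3F ∷ 5F ∷ 7F ∷ 9F ∷ []) ∷ []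

inside : Fin 10 → Bool
inside (suc (suc (suc _))) = true
inside _                   = false

inside⇒heptad : ∀ {p} → inside p ≡ true → ∃ λ x → p ≡ 3 Fin.↑ʳ x
inside⇒heptad {suc (suc (suc x))} _ = x , ≡.refl

heptadTest : (p q r s : Fin 10) → Bool
heptadTest p q r s = does (p ≟ q) ∨ does (r ≟ p) ∨ does (r ≟ q)
  ∨ refuted heptadWords (p ∷ q ∷ r ∷ s ∷ []) ∨ (inside p ∧ inside q) ∨ (inside r ∧ inside s)

abstract
  heptadTest-true : ∀ p q r s → heptadTest p q r s ≡ true
  heptadTest-true = from-yes (all? λ p → all? λ q → all? λ r → all? λ s → heptadTest p q r s Bool.≟ true)

-- A word of four distinct letters that commutes with the code e₇ meets its support in 0, 3 or 4 letters, and only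
-- three letters lie outside.
heptad-even : ∀ {p q r s} → p ≢ q → r ≢ p → r ≢ q → refuted heptadWords (p ∷ q ∷ r ∷ s ∷ []) ≡ false →
              (inside p ≡ true × inside q ≡ true) ⊎ (inside r ≡ true × inside s ≡ true)
heptad-even {p} {q} {r} {s} p≢q r≢p r≢q = remaining (inside p) (inside r)
  (heptadTest-true p q r s) (dec-false (p ≟ q) p≢q) (dec-false (r ≟ p) r≢p) (dec-false (r ≟ q) r≢q)
  where
  remaining : ∀ {a b c d} e {f} g {h} → a ∨ b ∨ c ∨ d ∨ (e ∧ f) ∨ (g ∧ h) ≡ true →
              a ≡ false → b ≡ false → c ≡ false → d ≡ false →
              (e ≡ true × f ≡ true) ⊎ (g ≡ true × h ≡ true)
  remaining true {true}  _    _ _ _ _ _ = inj₁ (≡.refl , ≡.refl)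
  remaining true {false} true ≡.refl ≡.refl ≡.refl ≡.refl ≡.refl = inj₂ (≡.refl , ≡.refl)
  remaining false        true ≡.refl ≡.refl ≡.refl ≡.refl ≡.refl = inj₂ (≡.refl , ≡.refl)

-- Marks what `quadruple` cannot return as third and fourth letters: its third letter differs from
-- `r` and `s`, and its word fixes a nonzero vector.
excluded : ∀ {n} → List (List (Fin n)) → (r s i j : Fin n) → Bool
excluded known r s i j = does (i ≟ r) ∨ does (i ≟ s) ∨ refuted known (r ∷ s ∷ i ∷ j ∷ [])

tetradWords : List (List (Fin 5))
tetradWords = (1F ∷ 2F ∷ 3F ∷ 4F ∷ []) ∷ []

abstract
  -- Words of even length commute exactly when they share an even number of letters. The letters 1
  -- and 0 with two further ones of 1234 share three with the tetrad, and a repeated letter leaves a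
  -- word of length two, whose square is -1.
  tetrad-meets : ∀ i j → excluded tetradWords 1F 0F i j ≡ true
  tetrad-meets = from-yes (all? λ i → all? λ j → excluded tetradWords 1F 0F i j Bool.≟ true)

-- The implicit `n` serves the hexad and the octad alike; in both, the label 0 is left to a row
-- outside.
tetrad₁ tetrad₂ : ∀ {n} → List (Fin (7 ℕ.+ n))
tetrad₁ = 1F ∷ 2F ∷ 3F ∷ 4F ∷ []
tetrad₂ = 1F ∷ 2F ∷ 5F ∷ 6F ∷ []

hexadWords : List (List (Fin 7))
hexadWords = tetrad₁ ∷ tetrad₂ ∷ []

choose : ∀ {a} {A : Set a} → Fin 2 → A → A → A
choose zero       p q = p
choose (suc zero) p q = q

-- A third word with one letter from each of the pairs 12, 34 and 56 completes tetrad₁ and tetrad₂ to a copy of e₇.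
hexadLabelling : Fin 2 → Fin 2 → Fin 7 → Fin 7
hexadLabelling x y = Vec.lookup
  (1F ∷ 2F ∷ choose x 3F 4F ∷ choose x 4F 3F ∷ choose y 5F 6F ∷ choose y 6F 5F ∷ 0F ∷ [])

-- A word with one letter from each of the pairs 12, 34, 56 and 78 also yields e₇; of the pair 78
-- only the chosen letter belongs to the copy.
octadLabelling : Fin 2 → Fin 2 → Fin 2 → Fin 2 → Fin 7 → Fin 9
octadLabelling e x y u = Vec.lookup
  (choose e 1F 2F ∷ choose e 2F 1F ∷ choose x 3F 4F ∷ choose x 4F 3F ∷ choose y 5F 6F ∷ choose y 6F 5F ∷ choose u 7F 8F ∷ [])

abstract
  -- To meet both tetrads evenly, 1 and 0 need either one letter from each of 34 and 56, which gives
  -- `heptad₃`, or the letter 2 and a second letter outside the hexad, for which there is no label.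
  hexad-meets : ∀ i j → excluded hexadWords 1F 0F i j ≡ true ⊎
    (∃₂ λ x y → Relabels (1F ∷ 0F ∷ i ∷ j ∷ []) (hexadLabelling x y) heptad₃)
  hexad-meets = from-yes (all? λ i → all? λ j → (excluded hexadWords 1F 0F i j Bool.≟ true) ⊎-dec
    any? λ x → any? λ y → relabels? (1F ∷ 0F ∷ i ∷ j ∷ []) (hexadLabelling x y) heptad₃)

  hexadLabelling-valid : ∀ x y → (∀ i j → hexadLabelling x y i ≡ hexadLabelling x y j → i ≡ j) ×
    Relabels tetrad₁ (hexadLabelling x y) heptad₁ ×
    Relabels tetrad₂ (hexadLabelling x y) heptad₂
  hexadLabelling-valid = from-yes (all? λ x → all? λ y → injective? (hexadLabelling x y) ×-dec
    relabels? tetrad₁ (hexadLabelling x y) heptad₁ ×-dec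
    relabels? tetrad₂ (hexadLabelling x y) heptad₂)

octadWords : List (List (Fin 9))
octadWords = tetrad₁ ∷ tetrad₂ ∷ (1F ∷ 2F ∷ 7F ∷ 8F ∷ []) ∷ []

-- The cells are chosen to carry distinct colours: apart from copies of e₇, the pairs 12, 34, 56 and 78 are the only
-- coincidences among the sums of two labels.
octadCell : Fin 17 → Fin 9 × Fin 3
octadCell = Vec.lookup
  ( (1F , 0F) ∷ (2F , 0F) ∷ (3F , 0F) ∷ (4F , 0F) ∷ (5F , 0F) ∷ (6F , 0F) ∷ (7F , 0F) ∷ (8F , 0F)
  ∷ (3F , 1F) ∷ (4F , 1F) ∷ (7F , 1F) ∷ (8F , 1F) ∷ (3F , 2F) ∷ (4F , 2F)
  ∷ (0F , 0F) ∷ (0F , 1F) ∷ (0F , 2F) ∷ [])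

octadColumn : Fin 3 → Fin 9
octadColumn = Vec.lookup (1F ∷ 5F ∷ 7F ∷ [])

octadLetters : Fin 17 → List (Fin 9)
octadLetters s = proj₁ (octadCell s) ∷ octadColumn (proj₂ (octadCell s)) ∷ []

abstract
  octadCell-collision : ∀ s t → s ≡ t ⊎ refuted octadWords (octadLetters s ++ octadLetters t) ≡ true ⊎
    (∃₂ λ e x → ∃₂ λ y u → Relabels (octadLetters s ++ octadLetters t) (octadLabelling e x y u) heptad₃)
  octadCell-collision = from-yes (all? λ s → all? λ t → (s ≟ t) ⊎-dec
    (refuted octadWords (octadLetters s ++ octadLetters t) Bool.≟ true) ⊎-dec
    any? λ e → any? λ x → any? λ y → any? λ u →
      relabels? (octadLetters s ++ octadLetters t) (octadLabelling e x y u) heptad₃)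

  octadLabelling-valid : ∀ e x y u → (∀ i j → octadLabelling e x y u i ≡ octadLabelling e x y u j → i ≡ j) ×
    Relabels tetrad₁ (octadLabelling e x y u) heptad₁ ×
    Relabels tetrad₂ (octadLabelling e x y u) heptad₂
  octadLabelling-valid = from-yes (all? λ e → all? λ x → all? λ y → all? λ u → injective? (octadLabelling e x y u) ×-dec
    relabels? tetrad₁ (octadLabelling e x y u) heptad₁ ×-dec
    relabels? tetrad₂ (octadLabelling e x y u) heptad₂)

-- Colour tables

module Table {c ℓ} {W : Setoid c ℓ} (A : AnticommutingInvolutions W 10) where
  open Setoid W using () renaming (Carrier to V)
  open AnticommutingInvolutions A
  open Words A

  module _
    (y : Fin 10 → V) (z : Fin 16 → V) (M : Fin 10 → Fin 10 → Fin 16)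
    (Ey∼z : ∀ i j → E i (y j) ∼ z (M i j))
    (y-injective : ∀ {j j′} → y j ∼ y j′ → j ≡ j′)
    (z-nonzero : ∀ k → Nonzero (z k))
    where

    open import Relation.Binary.Reasoning.Setoid ∼-setoid

    y-nonzero : ∀ j → Nonzero (y j)
    y-nonzero j = Nonzero-E 0F (Ey∼z 0F j) (z-nonzero (M 0F j))

    sameColour : ∀ {i j i′ j′} → M i j ≡ M i′ j′ → E i (y j) ∼ E i′ (y j′)
    sameColour {i} {j} {i′} {j′} eq = begin
      E i (y j)     ≈⟨ Ey∼z i j ⟩
      z (M i j)     ≡⟨ cong z eq ⟩
      z (M i′ j′)   ≈⟨ Ey∼z i′ j′ ⟨
      E i′ (y j′)   ∎

    row-injective : ∀ i {j j′} → M i j ≡ M i j′ → j ≡ j′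
    row-injective i eq = y-injective (E-cancel i (sameColour eq))

    column-injective : ∀ {i i′} j → M i j ≡ M i′ j → i ≡ i′
    column-injective {i} {i′} j eq =
      Fixes-pair (y-nonzero j) i i′ (∼-sym (E-transpose i (sameColour eq)))

    -- Eight cells of one column and ten of the other compete for 16 colours. The two rows left out
    -- discard coincidences that carry no information: trivial ones in `quadruple`, one already
    -- found in `column-class`.
    shared : ∀ {j j′} → j ≢ j′ → ∀ {p q} → p ≢ q →
             ∃₂ λ a b → (a ≢ p × a ≢ q) × M a j ≡ M b j′
    shared {j} {j′} j≢j′ {p} {q} p≢q =
      let s , t , s<t , eq = pigeonhole {16} {18} (ℕ.s≤s (ℕ.n≤1+n 16)) (colour ∘ splitAt 8)
      in go (splitAt 8 s) (splitAt 8 t) eq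
        (λ s≡t → <⇒≢ s<t (≡.trans (≡.sym (join-splitAt 8 10 s)) (≡.trans (cong (Fin.join 8 10) s≡t) (join-splitAt 8 10 t))))
      where
      row : Fin 8 → Fin 10
      row = punchIn p ∘ punchIn (punchOut p≢q)
      row≢p : ∀ x → row x ≢ p
      row≢p x = punchInᵢ≢i p _
      row≢q : ∀ x → row x ≢ q
      row≢q x eq = punchInᵢ≢i (punchOut p≢q) x
        (punchIn-injective p _ _ (≡.trans eq (≡.sym (punchIn-punchOut p≢q))))
      colour : Fin 8 ⊎ Fin 10 → Fin 16
      colour = [ (λ x → M (row x) j) , (λ b → M b j′) ]′
      go : ∀ s t → colour s ≡ colour t → s ≢ t → ∃₂ λ a b → (a ≢ p × a ≢ q) × M a j ≡ M b j′
      go (inj₁ x) (inj₁ x′) eq s≢t = contradiction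
        (cong inj₁ (punchIn-injective _ _ _ (punchIn-injective p _ _ (column-injective j eq)))) s≢t
      go (inj₁ x) (inj₂ b)  eq _   = row x , b , (row≢p x , row≢q x) , eq
      go (inj₂ b) (inj₁ x)  eq _   = row x , b , (row≢p x , row≢q x) , ≡.sym eq
      go (inj₂ b) (inj₂ b′) eq s≢t = contradiction (cong inj₂ (column-injective j′ eq)) s≢t

    cell : Fin 100 → Fin 10 × Fin 10
    cell = remQuot {10} 10

    cell-injective : Injective _≡_ _≡_ cell
    cell-injective {s} {t} eq = ≡.trans (≡.sym (combine-remQuot {10} 10 s))
      (≡.trans (cong (uncurry combine) eq) (combine-remQuot {10} 10 t))

    -- The seven cells lie in different rows because no row repeats a colour.
    frequentColour : ∃ λ k → ∃ λ (d : Fin 7 → Fin 10) → Injective _≡_ _≡_ d ×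
                     (∀ s → ∃ λ j → y j ∼ E (d s) (z k))
    -- Here 97 is 16 * 6 + 1.
    frequentColour = fromFibre (largeFibre {16} {6} {100} (λ s → M (proj₁ (cell s)) (proj₂ (cell s))) (ℕ.m≤m+n 97 3))
      where
      column : ∀ {i j k} → M i j ≡ k → y j ∼ E i (z k)
      column {i} {j} ≡.refl = E-transpose i (Ey∼z i j)
      fromFibre : (∃₂ λ k (g : Fin 7 → Fin 100) → Injective _≡_ _≡_ g ×
                     (∀ s → M (proj₁ (cell (g s))) (proj₂ (cell (g s))) ≡ k)) →
                  ∃ λ k → ∃ λ (d : Fin 7 → Fin 10) → Injective _≡_ _≡_ d × (∀ s → ∃ λ j → y j ∼ E (d s) (z k))
      fromFibre (k , g , g-inj , Mg≡k) = k , proj₁ ∘ cell ∘ g , d-injective , λ s → _ , column (Mg≡k s)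
        where
        d-injective : Injective _≡_ _≡_ (proj₁ ∘ cell ∘ g)
        d-injective {s} {t} eq = g-inj (cell-injective (cong₂ _,_ eq (row-injective (proj₁ (cell (g t)))
          (≡.trans (cong (λ i → M i (proj₂ (cell (g s)))) (≡.sym eq)) (≡.trans (Mg≡k s) (≡.sym (Mg≡k t)))))))

    -- A column that shares a colour with column `j₀` is E p E q y₀ up to sign. One shared colour
    -- may involve rows outside the heptad, but two of them give a fixed word of four letters, and
    -- `heptad-even` places one of the pairs inside. There e₇ leaves eight vectors for the nine
    -- other columns.
    heptad-impossible′ : ∀ j₀ {σ : Fin 10 → Fin 10} → Injective _≡_ _≡_ σ →
                         All (λ l → Fixes (map σ l) (y j₀)) heptadWords → ⊥
    heptad-impossible′ j₀ {σ} σ-inj words@(h₁ ∷ h₂ ∷ h₃ ∷ []) =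
      separate (λ j → column-class (punchIn j₀ j) (punchInᵢ≢i j₀ j))
      where
      y₀ : V
      y₀ = y j₀

      ρ : Fin 7 → Fin 10
      ρ = σ ∘ (3 Fin.↑ʳ_)

      word : Fin 8 → List (Fin 10)
      word s = map ρ (heptadWord s)

      heptadWord-fixes : ∀ s → Fixes (map ρ (heptadWord s)) y₀
      heptadWord-fixes 0F = ∼-refl
      heptadWord-fixes 1F = h₁
      heptadWord-fixes 2F = h₂
      heptadWord-fixes 3F = h₃
      heptadWord-fixes 4F = Fixes-++ (word 1F) (word 2F) {y₀} h₁ h₂
      heptadWord-fixes 5F = Fixes-++ (word 1F) (word 3F) {y₀} h₁ h₃
      heptadWord-fixes 6F = Fixes-++ (word 2F) (word 3F) {y₀} h₂ h₃
      heptadWord-fixes 7F = Fixes-++ (word 1F) (word 6F) {y₀} h₁ (heptadWord-fixes 6F)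

      Classified : V → Set ℓ
      Classified v = ∃ λ h → v ∼ E* (map ρ (heptadClass h)) y₀

      classify : ∀ x x′ → Classified (E (ρ x) (E (ρ x′) y₀))
      classify x x′ = let h , s , eq = heptad-classes x x′ in h , (begin
        E (ρ x) (E (ρ x′) y₀)
          ≈⟨ E*-parity ρ (x ∷ x′ ∷ []) (heptadClass h ++ heptadWord s) eq y₀ ⟩
        E* (map ρ (heptadClass h ++ heptadWord s)) y₀
          ≡⟨ cong (λ l → E* l y₀) (map-++ ρ (heptadClass h) (heptadWord s)) ⟩
        E* (map ρ (heptadClass h) ++ map ρ (heptadWord s)) y₀
          ≡⟨ E*-++ (map ρ (heptadClass h)) (map ρ (heptadWord s)) y₀ ⟩
        E* (map ρ (heptadClass h)) (E* (map ρ (heptadWord s)) y₀)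
          ≈⟨ E*-cong-∼ (map ρ (heptadClass h)) (heptadWord-fixes s) ⟩
        E* (map ρ (heptadClass h)) y₀ ∎)

      inside-class : ∀ {v} p q → v ∼ E (σ p) (E (σ q) y₀) → inside p ≡ true → inside q ≡ true →
                     Classified v
      inside-class p q v∼ p∈ q∈ with x , ≡.refl ← inside⇒heptad p∈ | x′ , ≡.refl ← inside⇒heptad q∈ =
        let h , eq = classify x x′ in h , ∼-trans v∼ eq

      label : ∀ a → ∃ λ p → σ p ≡ a
      label = surjective σ-inj

      between : ∀ {j p q} → M (σ p) j ≡ M (σ q) j₀ → y j ∼ E (σ p) (E (σ q) y₀)
      between {p = p} eq = E-transpose (σ p) (sameColour eq)

      consistent : ∀ {j} p q r s → M (σ p) j ≡ M (σ q) j₀ → M (σ r) j ≡ M (σ s) j₀ →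
                   refuted heptadWords (p ∷ q ∷ r ∷ s ∷ []) ≡ false
      consistent p q r s pq rs = Fixes⇒¬refuted (y-nonzero j₀) σ-inj {heptadWords} (p ∷ q ∷ r ∷ s ∷ []) words
        (agree⇒Fixes (σ p ∷ σ q ∷ []) (σ r ∷ σ s ∷ []) (∼-trans (∼-sym (between pq)) (between rs)))

      two-pairs : ∀ {j} p q r s → σ p ≢ σ q → σ r ≢ σ p → σ r ≢ σ q →
                  M (σ p) j ≡ M (σ q) j₀ → M (σ r) j ≡ M (σ s) j₀ → Classified (y j)
      two-pairs p q r s p≢q r≢p r≢q pq rs =
        [ uncurry (inside-class p q (between pq)) , uncurry (inside-class r s (between rs)) ]′
          (heptad-even {p} {q} {r} {s} (p≢q ∘ cong σ) (r≢p ∘ cong σ) (r≢q ∘ cong σ) (consistent p q r s pq rs))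

      relabelled : ∀ {j} (P : Fin 10 → Set) → (∃₂ λ a b → P a × M a j ≡ M b j₀) →
                   ∃₂ λ p q → P (σ p) × M (σ p) j ≡ M (σ q) j₀
      relabelled P (a , b , Pa , ab) = go (label a) (label b) Pa ab
        where
        go : ∀ {a b j} → (∃ λ p → σ p ≡ a) → (∃ λ q → σ q ≡ b) → P a → M a j ≡ M b j₀ →
             ∃₂ λ p q → P (σ p) × M (σ p) j ≡ M (σ q) j₀
        go (p , ≡.refl) (q , ≡.refl) Pa ab = p , q , Pa , ab

      column-class : ∀ j → j ≢ j₀ → Classified (y j)
      -- For the first coincidence any two distinct rows to avoid will do.
      column-class j j≢j₀ = first (relabelled (λ c → c ≢ 0F × c ≢ 1F) (shared j≢j₀ (λ ())))
        where
        first : (∃₂ λ p q → (σ p ≢ 0F × σ p ≢ 1F) × M (σ p) j ≡ M (σ q) j₀) → Classified (y j)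
        -- Avoiding both rows of the first coincidence makes r differ from p and q, as `heptad-even`
        -- requires.
        first (p , q , _ , pq) = second (relabelled (λ c → c ≢ σ p × c ≢ σ q) (shared j≢j₀ p≢q))
          where
          p≢q : σ p ≢ σ q
          p≢q eq = j≢j₀ (row-injective (σ p) (≡.trans pq (cong (λ i → M i j₀) (≡.sym eq))))
          second : (∃₂ λ r s → (σ r ≢ σ p × σ r ≢ σ q) × M (σ r) j ≡ M (σ s) j₀) → Classified (y j)
          second (r , s , (r≢p , r≢q) , rs) = two-pairs p q r s p≢q r≢p r≢q pq rs

      separate : (∀ j → Classified (y (punchIn j₀ j))) → ⊥
      separate class = go (pigeonhole {8} {9} ℕ.≤-refl (proj₁ ∘ class))
        where
        go : (∃₂ λ j j′ → j Fin.< j′ × proj₁ (class j) ≡ proj₁ (class j′)) → ⊥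
        go (j , j′ , j<j′ , eq) = <⇒≢ j<j′ (punchIn-injective j₀ j j′ (y-injective (begin
          y (punchIn j₀ j)                                ≈⟨ proj₂ (class j) ⟩
          E* (map ρ (heptadClass (proj₁ (class j)))) y₀   ≡⟨ cong (λ h → E* (map ρ (heptadClass h)) y₀) eq ⟩
          E* (map ρ (heptadClass (proj₁ (class j′)))) y₀  ≈⟨ proj₂ (class j′) ⟨
          y (punchIn j₀ j′)                               ∎)))

    -- Prepending the three rows outside the heptad completes `ρ` to a permutation and shifts the
    -- heptad to the labels 3 to 9 of `heptadWords`.
    heptad-impossible : ∀ j₀ {ρ : Fin 7 → Fin 10} → Injective _≡_ _≡_ ρ →
                        Fixes (map ρ heptad₁) (y j₀) →
                        Fixes (map ρ heptad₂) (y j₀) →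
                        Fixes (map ρ heptad₃) (y j₀) → ⊥
    heptad-impossible j₀ {ρ} ρ-inj h₁ h₂ h₃ =
      case missing ρ {id} id (ℕ.m≤n+m 8 2) of λ (a , a∉) →
      case missing (a Vector.∷ ρ) {id} id (ℕ.m≤n+m 9 1) of λ (b , b∉) →
      case missing (b Vector.∷ a Vector.∷ ρ) {id} id ℕ.≤-refl of λ (c , c∉) →
      heptad-impossible′ j₀ {c Vector.∷ b Vector.∷ a Vector.∷ ρ}
        (∷-injective {a = c} {ρ = b Vector.∷ a Vector.∷ ρ} c∉
          (∷-injective {a = b} {ρ = a Vector.∷ ρ} b∉ (∷-injective {a = a} {ρ = ρ} a∉ ρ-inj)))
        (h₁ ∷ h₂ ∷ h₃ ∷ [])

    -- Growing the code that fixes a frequent colour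

    module Base {w : V} (w≢0 : Nonzero w) where

      Column : Fin 10 → Set ℓ
      Column r = ∃ λ j → y j ∼ E r w

      sameColour-base : ∀ {a b r s} (r∈ : Column r) (s∈ : Column s) → M a (proj₁ r∈) ≡ M b (proj₁ s∈) →
                        E a (E r w) ∼ E b (E s w)
      sameColour-base {a} {b} {r} {s} (j , y∼) (j′ , y′∼) eq = begin
        E a (E r w)   ≈⟨ E-cong-∼ a y∼ ⟨
        E a (y j)     ≈⟨ sameColour eq ⟩
        E b (y j′)    ≈⟨ E-cong-∼ b y′∼ ⟩
        E b (E s w)   ∎

      -- E r commutes or anticommutes with every word. This carries the code found at the colour
      -- over to a column, where `heptad-impossible` applies.
      Fixes-base : ∀ {r} ((j , _) : Column r) l → Fixes l w → Fixes l (y j)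
      Fixes-base {r} (j , y∼) l h = Fixes-resp-∼ l (∼-sym y∼) (Fixes-E r l h)

      -- A shared colour says that E a E r w and E b E s w agree up to sign. The rows r and s are
      -- avoided because there the word cancels to the empty one.
      quadruple : ∀ {r s} → Column r → Column s → r ≢ s →
                  ∃₂ λ a b → (a ≢ r × a ≢ s) × Fixes (r ∷ s ∷ a ∷ b ∷ []) w
      quadruple {r} {s} r∈@(j , y∼) s∈@(j′ , y′∼) r≢s = go (shared j≢j′ r≢s)
        where
        j≢j′ : j ≢ j′
        j≢j′ ≡.refl = r≢s (Fixes-pair w≢0 r s (∼-sym (E-transpose r (∼-trans (∼-sym y∼) y′∼))))
        go : (∃₂ λ a b → (a ≢ r × a ≢ s) × M a j ≡ M b j′) →
             ∃₂ λ a b → (a ≢ r × a ≢ s) × Fixes (r ∷ s ∷ a ∷ b ∷ []) w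
        go (a , b , a≢ , eq) = a , b , a≢ ,
          -- The agreement gives the word a, r, b, s, here sorted into r, s, a, b.
          Fixes-parity (Vec.lookup (r ∷ s ∷ a ∷ b ∷ [])) (2F ∷ 0F ∷ 3F ∷ 1F ∷ []) (0F ∷ 1F ∷ 2F ∷ 3F ∷ []) ≡.refl
            (agree⇒Fixes (a ∷ r ∷ []) (b ∷ s ∷ []) (sameColour-base r∈ s∈ eq))

      AllFix : ∀ {k} → (Fin k → Fin 10) → List (List (Fin k)) → Set ℓ
      AllFix ρ = All (λ l → Fixes (map ρ l) w)

      shift : ∀ {k} {ρ : Fin k → Fin 10} {known} a → AllFix ρ known → AllFix (a Vector.∷ ρ) (map (map suc) known)
      shift a hs = All.map⁺ (All.map (λ {l} → subst (λ l′ → Fixes l′ w) (map-∘ l)) hs)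

      record Extension {k} (ρ : Fin k → Fin 10) (known : List (List (Fin k))) (r s i j : Fin k) : Set ℓ where
        field
          injective   : Injective _≡_ _≡_ ρ
          fixes       : Fixes (map ρ (r ∷ s ∷ i ∷ j ∷ [])) w
          notExcluded : excluded known r s i j ≡ false

      extension : ∀ {k} {ρ : Fin k → Fin 10} {known r s i j} → Injective _≡_ _≡_ ρ → AllFix ρ known →
                  i ≢ r → i ≢ s → Fixes (map ρ (r ∷ s ∷ i ∷ j ∷ [])) w → Extension ρ known r s i j
      extension {r = r} {s} {i} {j} ρ-inj hs i≢r i≢s h = record
        { injective = ρ-inj
        ; fixes = h
        ; notExcluded = cong₂ _∨_ (dec-false (i ≟ r) i≢r) (cong₂ _∨_ (dec-false (i ≟ s) i≢s)
            (Fixes⇒¬refuted w≢0 ρ-inj (r ∷ s ∷ i ∷ j ∷ []) hs h))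
        }

      -- New rows are prepended, which shifts the labels of the old ones.
      data Completion {k} (ρ : Fin k → Fin 10) (known : List (List (Fin k))) (r s : Fin k) : Set ℓ where
        none : ∀ i j → Extension ρ known r s i j → Completion ρ known r s
        one  : ∀ a i → Extension (a Vector.∷ ρ) (map (map suc) known) (suc r) (suc s) 0F (suc i) → Completion ρ known r s
        two  : ∀ a b → Extension (b Vector.∷ a Vector.∷ ρ) (map (map suc) (map (map suc) known))
                                 (suc (suc r)) (suc (suc s)) 1F 0F →
               Completion ρ known r s

      complete : ∀ {k} {ρ : Fin k → Fin 10} {known} → Injective _≡_ _≡_ ρ → AllFix ρ known →
                 ∀ {r s} → Column (ρ r) → Column (ρ s) → r ≢ s → Completion ρ known r s
      complete {ρ = ρ} ρ-inj hs {r} {s} r∈ s∈ r≢s = go (quadruple r∈ s∈ (r≢s ∘ ρ-inj))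
        where
        label? : ∀ a → Dec (∃ λ i → a ≡ ρ i)
        label? a = any? λ i → a ≟ ρ i
        swapped : ∀ {a b} → Fixes (ρ r ∷ ρ s ∷ a ∷ b ∷ []) w → Fixes (ρ r ∷ ρ s ∷ b ∷ a ∷ []) w
        swapped {a} {b} = Fixes-parity (Vec.lookup (ρ r ∷ ρ s ∷ a ∷ b ∷ []))
          (0F ∷ 1F ∷ 2F ∷ 3F ∷ []) (0F ∷ 1F ∷ 3F ∷ 2F ∷ []) ≡.refl
        go : (∃₂ λ a b → (a ≢ ρ r × a ≢ ρ s) × Fixes (ρ r ∷ ρ s ∷ a ∷ b ∷ []) w) → Completion ρ _ r s
        go (a , b , (a≢r , a≢s) , h) with label? a | label? b
        ... | yes (i , ≡.refl) | yes (j , ≡.refl) = none i j (extension ρ-inj hs (a≢r ∘ cong ρ) (a≢s ∘ cong ρ) h)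
        ... | no  a∉           | yes (j , ≡.refl) =
          one a j (extension (∷-injective (λ i eq → a∉ (i , eq)) ρ-inj) (shift a hs) (λ ()) (λ ()) h)
        -- The new row moves to the third place, so that `one` serves both orders.
        ... | yes (i , ≡.refl) | no  b∉           =
          one b i (extension (∷-injective (λ i eq → b∉ (i , eq)) ρ-inj) (shift b hs) (λ ()) (λ ()) (swapped h))
        ... | no  a∉           | no  b∉           = two a b
          (extension (∷-injective b∉′ (∷-injective (λ i eq → a∉ (i , eq)) ρ-inj)) (shift b (shift a hs)) (λ ()) (λ ()) h)
          where
          b∉′ : Missing (a Vector.∷ ρ) b
          b∉′ (suc i) eq = b∉ (i , eq)
          -- If the two new rows coincided, the word would cancel to `ρ r`, `ρ s`.
          b∉′ zero    ≡.refl = r≢s (ρ-inj (Fixes-pair w≢0 (ρ r) (ρ s)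
            (Fixes-parity (Vec.lookup (ρ r ∷ ρ s ∷ a ∷ [])) (0F ∷ 1F ∷ 2F ∷ 2F ∷ []) (0F ∷ 1F ∷ []) ≡.refl h)))

      relabel : ∀ {m k} {ρ : Fin k → Fin 10} l (π : Fin m → Fin k) l′ → Relabels l π l′ →
                Fixes (map ρ l) w → Fixes (map (ρ ∘ π) l′) w
      relabel {ρ = ρ} l π l′ eq h = subst (λ l″ → Fixes l″ w) (≡.sym (map-∘ l′))
        (Fixes-parity ρ l (map π l′) eq h)

      heptad : ∀ {k} {ρ : Fin k → Fin 10} → Injective _≡_ _≡_ ρ → ∀ {r} → Column r → (π : Fin 7 → Fin k) →
               (∀ i j → π i ≡ π j → i ≡ j) → ∀ l₁ l₂ l₃ →
               Relabels l₁ π heptad₁ → Relabels l₂ π heptad₂ →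
               Relabels l₃ π heptad₃ →
               Fixes (map ρ l₁) w → Fixes (map ρ l₂) w → Fixes (map ρ l₃) w → ⊥
      heptad {ρ = ρ} ρ-inj r∈ π π-inj l₁ l₂ l₃ e₁ e₂ e₃ h₁ h₂ h₃ =
        heptad-impossible (proj₁ r∈) {ρ ∘ π} (λ eq → π-inj _ _ (ρ-inj eq))
          (Fixes-base r∈ (map (ρ ∘ π) heptad₁) (relabel l₁ π heptad₁ e₁ h₁))
          (Fixes-base r∈ (map (ρ ∘ π) heptad₂) (relabel l₂ π heptad₂ e₂ h₂))
          (Fixes-base r∈ (map (ρ ∘ π) heptad₃) (relabel l₃ π heptad₃ e₃ h₃))

      -- Modulo d₈ the sums of two labels of the octad form 14 classes: the empty word, the four
      -- pairs together, and twelve classes of two words each. Three columns on different pairs meet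
      -- them all, and a ninth row adds a class in each of these columns. Unless e₇ occurs, the 17
      -- classes have distinct colours.
      octad-impossible : ∀ {ρ : Fin 8 → Fin 10} → Injective _≡_ _≡_ ρ →
                         Column (ρ 0F) → Column (ρ 4F) → Column (ρ 6F) →
                         Fixes (map ρ (0F ∷ 1F ∷ 2F ∷ 3F ∷ [])) w →
                         Fixes (map ρ (0F ∷ 1F ∷ 4F ∷ 5F ∷ [])) w →
                         Fixes (map ρ (0F ∷ 1F ∷ 6F ∷ 7F ∷ [])) w → ⊥
      octad-impossible {ρ} ρ-inj c₀ c₄ c₆ h₁ h₂ h₃ =
        case missing ρ {id} id (ℕ.m≤n+m 9 1) of λ (a , a∉) → ninth a (∷-injective {a = a} {ρ = ρ} a∉ ρ-inj)
        where
        module _ (a : Fin 10) (σ-inj : Injective _≡_ _≡_ (a Vector.∷ ρ)) where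
          σ : Fin 9 → Fin 10
          σ = a Vector.∷ ρ
          column : ∀ c → Column (σ (octadColumn c))
          column 0F = c₀
          column 1F = c₄
          column 2F = c₆
          colour : Fin 17 → Fin 16
          colour s = M (σ (proj₁ (octadCell s))) (proj₁ (column (proj₂ (octadCell s))))
          collision : (∃₂ λ s t → s Fin.< t × colour s ≡ colour t) → ⊥
          collision (s , t , s<t , eq) = go (octadCell-collision s t)
            where
            fixed : Fixes (map σ (octadLetters s ++ octadLetters t)) w
            fixed = agree⇒Fixes (map σ (octadLetters s)) (map σ (octadLetters t))
              (sameColour-base (column (proj₂ (octadCell s))) (column (proj₂ (octadCell t))) eq)
            go : s ≡ t ⊎ refuted octadWords (octadLetters s ++ octadLetters t) ≡ true ⊎
                 (∃₂ λ e x → ∃₂ λ y u → Relabels (octadLetters s ++ octadLetters t) (octadLabelling e x y u) heptad₃) → ⊥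
            go (inj₁ s≡t) = <⇒≢ s<t s≡t
            go (inj₂ (inj₁ ref)) = case ≡.trans (≡.sym ref)
              (Fixes⇒¬refuted w≢0 σ-inj {octadWords} (octadLetters s ++ octadLetters t) (h₁ ∷ h₂ ∷ h₃ ∷ []) fixed) of λ ()
            go (inj₂ (inj₂ (e , x , y , u , e₃))) =
              let π-inj , e₁ , e₂ = octadLabelling-valid e x y u in
              heptad σ-inj c₀ (octadLabelling e x y u) π-inj tetrad₁ tetrad₂ (octadLetters s ++ octadLetters t)
                e₁ e₂ e₃ h₁ h₂ fixed
          ninth : ⊥
          ninth = collision (pigeonhole {16} {17} ℕ.≤-refl colour)

      -- Six rows cannot hold all seven columns, so some column belongs to a row a outside. Its word
      -- with the column on `ρ 0F` either stays within the hexad and a, which yields e₇, or brings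
      -- in one more row, which yields the octad.
      hexad-impossible : ∀ {d : Fin 7 → Fin 10} → Injective _≡_ _≡_ d → (∀ s → Column (d s)) →
                         ∀ {ρ : Fin 6 → Fin 10} → Injective _≡_ _≡_ ρ → Column (ρ 0F) → Column (ρ 4F) →
                         Fixes (map ρ (0F ∷ 1F ∷ 2F ∷ 3F ∷ [])) w →
                         Fixes (map ρ (0F ∷ 1F ∷ 4F ∷ 5F ∷ [])) w → ⊥
      hexad-impossible {d} d-inj d∈ {ρ} ρ-inj c₀ c₄ h₁ h₂ =
        case missing ρ d-inj ℕ.≤-refl of λ (s , s∉) →
        go (d s) (d∈ s) (complete {known = hexadWords} (∷-injective {a = d s} {ρ = ρ} s∉ ρ-inj)
          (h₁ ∷ h₂ ∷ []) {1F} {0F} c₀ (d∈ s) λ ())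
        where
        go : ∀ a → Column a → Completion (a Vector.∷ ρ) hexadWords 1F 0F → ⊥
        go a a∈ (none i j E) = decide (hexad-meets i j)
          where
          open Extension E
          decide : _ → ⊥
          decide (inj₁ ex) = case ≡.trans (≡.sym ex) notExcluded of λ ()
          decide (inj₂ (x , y , e₃)) = let π-inj , e₁ , e₂ = hexadLabelling-valid x y in
            heptad injective c₀ (hexadLabelling x y) π-inj tetrad₁ tetrad₂ (1F ∷ 0F ∷ i ∷ j ∷ []) e₁ e₂ e₃ h₁ h₂ fixes
        -- With b new, the old letter beside `ρ 0F` must lie in both tetrads to keep the overlaps
        -- even. This leaves `ρ 1F`, and a, b form the fourth pair.
        go a a∈ (one b 2F E) = octad-impossible {(b Vector.∷ a Vector.∷ ρ) ∘ π} (λ eq → π-injective (injective eq)) c₀ c₄ a∈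
          h₁ h₂ (relabel {ρ = b Vector.∷ a Vector.∷ ρ} (2F ∷ 1F ∷ 0F ∷ 3F ∷ []) π (0F ∷ 1F ∷ 6F ∷ 7F ∷ []) ≡.refl fixes)
          where
          open Extension E
          π : Fin 8 → Fin 8
          π = Vec.lookup (2F ∷ 3F ∷ 4F ∷ 5F ∷ 6F ∷ 7F ∷ 1F ∷ 0F ∷ [])
          π-injective : Injective _≡_ _≡_ π
          π-injective {i} {j} = from-yes (injective? π) i j
        go a a∈ (one b 0F E) = case Extension.notExcluded E of λ ()
        go a a∈ (one b 1F E) = case Extension.notExcluded E of λ ()
        go a a∈ (one b 3F E) = case Extension.notExcluded E of λ ()
        go a a∈ (one b 4F E) = case Extension.notExcluded E of λ ()
        go a a∈ (one b 5F E) = case Extension.notExcluded E of λ ()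
        go a a∈ (one b 6F E) = case Extension.notExcluded E of λ ()
        go a a∈ (two b c E)  = case Extension.notExcluded E of λ ()

      -- A column on a row a outside the tetrad gives a word with an even overlap: it consists of
      -- `ρ 0F`, one further letter of the tetrad, a, and a new row b.
      tetrad-impossible : ∀ {d : Fin 7 → Fin 10} → Injective _≡_ _≡_ d → (∀ s → Column (d s)) →
                          ∀ {ρ : Fin 4 → Fin 10} → Injective _≡_ _≡_ ρ → Column (ρ 0F) →
                          Fixes (map ρ (0F ∷ 1F ∷ 2F ∷ 3F ∷ [])) w → ⊥
      tetrad-impossible {d} d-inj d∈ {ρ} ρ-inj c₀ h₁ =
        case missing ρ d-inj (ℕ.m≤n+m 5 2) of λ (s , s∉) →
        go (d s) (d∈ s) (complete {known = tetradWords} (∷-injective {a = d s} {ρ = ρ} s∉ ρ-inj)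
          (h₁ ∷ []) {1F} {0F} c₀ (d∈ s) λ ())
        where
        -- Besides the label 2F, `x₁` is the letter common to both tetrads. The row a, which carries
        -- a column, takes the position 4F.
        hexad : ∀ a b {i} → Column a → Extension (b Vector.∷ a Vector.∷ ρ) (map (map suc) tetradWords) 2F 1F 0F i →
                ∀ x₁ x₂ x₃ → let π = Vec.lookup (2F ∷ x₁ ∷ x₂ ∷ x₃ ∷ 1F ∷ 0F ∷ []) in
                {True (injective? π)} →
                Relabels (2F ∷ 3F ∷ 4F ∷ 5F ∷ []) π (0F ∷ 1F ∷ 2F ∷ 3F ∷ []) →
                Relabels (2F ∷ 1F ∷ 0F ∷ i ∷ []) π (0F ∷ 1F ∷ 4F ∷ 5F ∷ []) → ⊥
        hexad a b {i} a∈ E x₁ x₂ x₃ {π-inj} e₁ e₂ = hexad-impossible d-inj d∈ {(b Vector.∷ a Vector.∷ ρ) ∘ π}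
          (λ eq → toWitness π-inj _ _ (Extension.injective E eq)) c₀ a∈
          (relabel {ρ = b Vector.∷ a Vector.∷ ρ} (2F ∷ 3F ∷ 4F ∷ 5F ∷ []) π (0F ∷ 1F ∷ 2F ∷ 3F ∷ []) e₁ h₁)
          (relabel {ρ = b Vector.∷ a Vector.∷ ρ} (2F ∷ 1F ∷ 0F ∷ i ∷ []) π (0F ∷ 1F ∷ 4F ∷ 5F ∷ []) e₂ (Extension.fixes E))
          where
          π : Fin 6 → Fin 6
          π = Vec.lookup (2F ∷ x₁ ∷ x₂ ∷ x₃ ∷ 1F ∷ 0F ∷ [])
        go : ∀ a → Column a → Completion (a Vector.∷ ρ) tetradWords 1F 0F → ⊥
        go a a∈ (none i j E) = case ≡.trans (≡.sym (tetrad-meets i j)) (Extension.notExcluded E) of λ ()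
        go a a∈ (one b 2F E) = hexad a b a∈ E 3F 4F 5F ≡.refl ≡.refl
        go a a∈ (one b 3F E) = hexad a b a∈ E 4F 3F 5F ≡.refl ≡.refl
        go a a∈ (one b 4F E) = hexad a b a∈ E 5F 3F 4F ≡.refl ≡.refl
        go a a∈ (one b 0F E) = case Extension.notExcluded E of λ ()
        go a a∈ (one b 1F E) = case Extension.notExcluded E of λ ()
        go a a∈ (two b c E)  = case Extension.notExcluded E of λ ()

      -- Two columns already yield a tetrad: the third letter differs from the first two, and
      -- repeating one of them as the fourth would leave a word of length two.
      sevenColumns-impossible : ∀ {d : Fin 7 → Fin 10} → Injective _≡_ _≡_ d → (∀ s → Column (d s)) → ⊥
      sevenColumns-impossible {d} d-inj d∈ =
        go (complete {ρ = ρ} {[]} ρ-inj [] {0F} {1F} (d∈ 0F) (d∈ 1F) λ ())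
        where
        ρ : Fin 2 → Fin 10
        ρ = d ∘ Vec.lookup (0F ∷ 1F ∷ [])
        ρ-inj : Injective _≡_ _≡_ ρ
        ρ-inj {i} {j} eq = from-yes (injective? (Vec.lookup {n = 2} (0F ∷ 1F ∷ []))) i j (d-inj eq)
        go : Completion ρ [] 0F 1F → ⊥
        go (none 0F j E)  = case Extension.notExcluded E of λ ()
        go (none 1F j E)  = case Extension.notExcluded E of λ ()
        go (one b 0F E) = case Extension.notExcluded E of λ ()
        go (one b 1F E) = case Extension.notExcluded E of λ ()
        go (two a b E)  = tetrad-impossible d-inj d∈ {(b Vector.∷ a Vector.∷ ρ) ∘ π}
          (λ eq → π-injective (injective eq)) (d∈ 0F)
          (relabel {ρ = b Vector.∷ a Vector.∷ ρ} (2F ∷ 3F ∷ 1F ∷ 0F ∷ []) π (0F ∷ 1F ∷ 2F ∷ 3F ∷ []) ≡.refl fixes)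
          where
          open Extension E
          π : Fin 4 → Fin 4
          π = Vec.lookup (2F ∷ 3F ∷ 1F ∷ 0F ∷ [])
          π-injective : Injective _≡_ _≡_ π
          π-injective {i} {j} = from-yes (injective? π) i j

    no-table : ⊥
    no-table = go frequentColour
      where
      go : (∃ λ k → ∃ λ (d : Fin 7 → Fin 10) → Injective _≡_ _≡_ d × (∀ s → ∃ λ j → y j ∼ E (d s) (z k))) → ⊥
      go (k , d , d-inj , d∈) = Base.sevenColumns-impossible (z-nonzero k) d-inj d∈

-- Orthogonal families over a formally real ring

module InnerProduct {c ℓ} (R : CommutativeRing c ℓ) where
  open CommutativeRing R hiding (zero)
  open import Algebra.Properties.Semiring.Sum semiring
  open import Algebra.Properties.Ring ring using (-0#≈0#; -‿involutive; -1*x≈-x; +-cancelʳ; +-inverseˡ-unique; x∙y⁻¹≈ε⇒x≈y)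
  open import Algebra.Solver.Ring.NaturalCoefficients.Default commutativeSemiring using (solve; _:+_; _:*_; _:=_)
  open import Relation.Binary.Reasoning.Setoid setoid

  R^ : ℕ → Set c
  R^ n = Vector Carrier n

  open VectorEquality setoid using (_≋_; ≋-setoid)

  infixl 6 _+ᵛ_
  infixl 7 _·_

  _+ᵛ_ : ∀ {n} → R^ n → R^ n → R^ n
  (x +ᵛ y) i = x i + y i

  _·_ : ∀ {n} → Carrier → R^ n → R^ n
  (a · x) i = a * x i

  -ᵛ_ : ∀ {n} → R^ n → R^ n
  (-ᵛ x) i = - x i

  ⟪_,_⟫ : ∀ {n} → R^ n → R^ n → Carrier
  ⟪ x , y ⟫ = sum (λ i → x i * y i)

  ε : ∀ {n} → Fin n → R^ n
  ε i j = if does (i ≟ j) then 1# else 0#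

  sum-zero : ∀ {n} {f : R^ n} → (∀ i → f i ≈ 0#) → sum f ≈ 0#
  sum-zero {n} f≈0 = trans (sum-cong-≋ f≈0) (sum-replicate-zero n)

  ⟪⟫-cong : ∀ {n} {x x′ y y′ : R^ n} → x ≋ x′ → y ≋ y′ → ⟪ x , y ⟫ ≈ ⟪ x′ , y′ ⟫
  ⟪⟫-cong x≋ y≋ = sum-cong-≋ (λ i → *-cong (x≋ i) (y≋ i))

  ⟪⟫-comm : ∀ {n} (x y : R^ n) → ⟪ x , y ⟫ ≈ ⟪ y , x ⟫
  ⟪⟫-comm x y = sum-cong-≋ (λ i → *-comm (x i) (y i))

  ⟪⟫-+ˡ : ∀ {n} (x y z : R^ n) → ⟪ x +ᵛ y , z ⟫ ≈ ⟪ x , z ⟫ + ⟪ y , z ⟫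
  ⟪⟫-+ˡ x y z = trans (sum-cong-≋ λ i → distribʳ (z i) (x i) (y i)) (∑-distrib-+ (λ i → x i * z i) (λ i → y i * z i))

  ⟪⟫-·ʳ : ∀ {n} a (x y : R^ n) → ⟪ x , a · y ⟫ ≈ a * ⟪ x , y ⟫
  ⟪⟫-·ʳ a x y = trans
    (sum-cong-≋ λ i → solve 3 (λ a x y → x :* (a :* y) := a :* (x :* y)) refl a (x i) (y i))
    (sym (*-distribˡ-sum a (λ i → x i * y i)))

  ⟪⟫-zeroʳ : ∀ {n} (x : R^ n) {y : R^ n} → (∀ i → y i ≈ 0#) → ⟪ x , y ⟫ ≈ 0#
  ⟪⟫-zeroʳ x y≈0 = sum-zero λ i → trans (*-congˡ (y≈0 i)) (zeroʳ (x i))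

  ⟪⟫-neg : ∀ {n} (x y : R^ n) → ⟪ x , -ᵛ y ⟫ ≈ - ⟪ x , y ⟫
  ⟪⟫-neg x y = trans (⟪⟫-cong {x = x} (λ _ → refl) (λ i → sym (-1*x≈-x (y i))))
    (trans (⟪⟫-·ʳ (- 1#) x y) (-1*x≈-x _))

  ε-suc : ∀ {n} (i j : Fin n) → ε (suc i) (suc j) ≈ ε i j
  ε-suc i j with i ≟ j
  ... | yes _ = refl
  ... | no  _ = refl

  ε-refl : ∀ {n} (i : Fin n) → ε i i ≈ 1#
  ε-refl i with i ≟ i
  ... | yes _  = refl
  ... | no i≢i = contradiction ≡.refl i≢i

  ε-≢ : ∀ {n} {i j : Fin n} → i ≢ j → ε i j ≈ 0#
  ε-≢ {i = i} {j} i≢j with i ≟ j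
  ... | yes i≡j = contradiction i≡j i≢j
  ... | no  _   = refl

  ε-sym : ∀ {n} (i j : Fin n) → ε i j ≈ ε j i
  ε-sym i j with i ≟ j
  ... | yes ≡.refl = sym (ε-refl i)
  ... | no  i≢j    = sym (ε-≢ (i≢j ∘ ≡.sym))

  ⟪ε⟫ : ∀ {n} (i : Fin n) (x : R^ n) → ⟪ ε i , x ⟫ ≈ x i
  ⟪ε⟫ zero    x = trans (+-cong (*-identityˡ _) (sum-zero λ i → zeroˡ (x (suc i)))) (+-identityʳ _)
  ⟪ε⟫ (suc i) x = trans (+-cong (zeroˡ _) (trans (sum-cong-≋ λ j → *-congʳ (ε-suc i j)) (⟪ε⟫ i (x ∘ suc))))
    (+-identityˡ _)

  bilinear-ε : ∀ {m n} (C : Fin m → Fin n → Carrier) i j →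
               sum (λ i′ → sum (λ j′ → C i′ j′ * (ε i i′ * ε j j′))) ≈ C i j
  bilinear-ε C i j = begin
    sum (λ i′ → sum (λ j′ → C i′ j′ * (ε i i′ * ε j j′)))
      ≈⟨ sum-cong-≋ (λ i′ → sum-cong-≋ λ j′ → solve 3 (λ c e e′ → c :* (e :* e′) := e :* (e′ :* c)) refl (C i′ j′) (ε i i′) (ε j j′)) ⟩
    sum (λ i′ → sum (λ j′ → ε i i′ * (ε j j′ * C i′ j′)))
      ≈⟨ sum-cong-≋ (λ i′ → *-distribˡ-sum (ε i i′) (λ j′ → ε j j′ * C i′ j′)) ⟨
    ⟪ ε i , (λ i′ → ⟪ ε j , C i′ ⟫) ⟫
      ≈⟨ ⟪ε⟫ i (λ i′ → ⟪ ε j , C i′ ⟫) ⟩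
    ⟪ ε j , C i ⟫
      ≈⟨ ⟪ε⟫ j (C i) ⟩
    C i j ∎

  record Linear {m n} (f : R^ m → R^ n) : Set (c ⊔ ℓ) where
    field
      f-cong : ∀ {x y} → x ≋ y → f x ≋ f y
      f-+    : ∀ x y → f (x +ᵛ y) ≋ (f x +ᵛ f y)
      f-·    : ∀ a x → f (a · x) ≋ a · f x

    f-0 : ∀ {x} → (∀ i → x i ≈ 0#) → ∀ k → f x k ≈ 0#
    f-0 {x} x≈0 k = trans (f-cong (λ i → trans (x≈0 i) (sym (zeroˡ (x i)))) k) (trans (f-· 0# x k) (zeroˡ _))

    f-neg : ∀ x → f (-ᵛ x) ≋ -ᵛ f x
    f-neg x k = trans (f-cong (λ i → sym (-1*x≈-x (x i))) k) (trans (f-· (- 1#) x k) (-1*x≈-x _))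

    f-sum : ∀ {l} (a : Fin l → Carrier) (v : Fin l → R^ m) k →
            f (λ i → sum (λ s → a s * v s i)) k ≈ sum (λ s → a s * f (v s) k)
    f-sum {zero}  a v k = f-0 (λ _ → refl) k
    f-sum {suc l} a v k = trans (f-+ (a zero · v zero) _ k)
      (+-cong (f-· (a zero) (v zero) k) (f-sum (a ∘ suc) (v ∘ suc) k))

    expand : ∀ x k → f x k ≈ sum (λ l → x l * f (ε l) k)
    expand x k = trans (f-cong (λ i → sym (trans (sum-cong-≋ λ l → trans (*-comm _ _) (*-congʳ (ε-sym l i))) (⟪ε⟫ i x))) k)
      (f-sum x ε k)

  -- Definiteness stands in for an order and for division by 2. The double sum is the squared
  -- Frobenius norm, as used in `gram≈ε`.
  module FormallyReal (definite : ∀ {m n} (x : Fin m → Fin n → Carrier) →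
                                  sum (λ i → sum (λ j → x i j * x i j)) ≈ 0# → ∀ i j → x i j ≈ 0#) where

    -- With d = a - b, the sum of squares d d + d d = d (d + d) vanishes.
    halve : ∀ {a b} → a + a ≈ b + b → a ≈ b
    halve {a} {b} 2a≈2b = x∙y⁻¹≈ε⇒x≈y a b (definite {1} {2} (λ _ _ → d) (begin
      d * d + (d * d + 0#) + 0#    ≈⟨ trans (+-identityʳ _) (+-congˡ (+-identityʳ _)) ⟩
      d * d + d * d                ≈⟨ distribˡ d d d ⟨
      d * (d + d)                  ≈⟨ *-congˡ d+d≈0 ⟩
      d * 0#                       ≈⟨ zeroʳ d ⟩
      0#                           ∎) zero zero)
      where
      d : Carrier
      d = a + - b
      d+d≈0 : d + d ≈ 0#
      d+d≈0 = begin
        (a + - b) + (a + - b)   ≈⟨ solve 2 (λ a b → (a :+ b) :+ (a :+ b) := (a :+ a) :+ (b :+ b)) refl a (- b) ⟩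
        (a + a) + (- b + - b)   ≈⟨ +-congʳ 2a≈2b ⟩
        (b + b) + (- b + - b)   ≈⟨ solve 2 (λ b c → (b :+ b) :+ (c :+ c) := (b :+ c) :+ (b :+ c)) refl b (- b) ⟩
        (b + - b) + (b + - b)   ≈⟨ +-cong (-‿inverseʳ b) (-‿inverseʳ b) ⟩
        0# + 0#                 ≈⟨ +-identityˡ 0# ⟩
        0#                      ∎

    record IsSymmetricForm {n} (B : R^ n → R^ n → Carrier) : Set (c ⊔ ℓ) where
      field
        symmetric : ∀ x y → B x y ≈ B y x
        additive  : ∀ x y z → B (x +ᵛ y) z ≈ B x z + B y z

      square : ∀ x y → B (x +ᵛ y) (x +ᵛ y) ≈ (B x x + B y y) + (B x y + B x y)
      square x y = begin
        B (x +ᵛ y) (x +ᵛ y)                  ≈⟨ additive x y _ ⟩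
        B x (x +ᵛ y) + B y (x +ᵛ y)
          ≈⟨ +-cong (trans (symmetric _ _) (additive x y x)) (trans (symmetric _ _) (additive x y y)) ⟩
        (B x x + B y x) + (B x y + B y y)    ≈⟨ +-congʳ (+-congˡ (symmetric y x)) ⟩
        (B x x + B x y) + (B x y + B y y)
          ≈⟨ solve 3 (λ a b c → (a :+ b) :+ (b :+ c) := (a :+ c) :+ (b :+ b)) refl _ _ _ ⟩
        (B x x + B y y) + (B x y + B x y)    ∎

    polarize : ∀ {n} {B B′ : R^ n → R^ n → Carrier} → IsSymmetricForm B → IsSymmetricForm B′ →
               (∀ x → B x x ≈ B′ x x) → ∀ x y → B x y ≈ B′ x y
    polarize {B = B} {B′} S S′ eq x y = halve (+-cancelʳ (B x x + B y y) _ _ (begin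
      (B x y + B x y) + (B x x + B y y)       ≈⟨ +-comm _ _ ⟩
      (B x x + B y y) + (B x y + B x y)       ≈⟨ IsSymmetricForm.square S x y ⟨
      B (x +ᵛ y) (x +ᵛ y)                     ≈⟨ eq (x +ᵛ y) ⟩
      B′ (x +ᵛ y) (x +ᵛ y)                    ≈⟨ IsSymmetricForm.square S′ x y ⟩
      (B′ x x + B′ y y) + (B′ x y + B′ x y)   ≈⟨ +-congʳ (+-cong (eq x) (eq y)) ⟨
      (B x x + B y y) + (B′ x y + B′ x y)     ≈⟨ +-comm _ _ ⟩
      (B′ x y + B′ x y) + (B x x + B y y)     ∎))

    ⟪⟫-form : ∀ {n} → IsSymmetricForm {n} ⟪_,_⟫
    ⟪⟫-form = record { symmetric = ⟪⟫-comm ; additive = ⟪⟫-+ˡ }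

    pullback : ∀ {m n} {f : R^ m → R^ n} → Linear f → IsSymmetricForm (λ x y → ⟪ f x , f y ⟫)
    pullback {f = f} L = record
      { symmetric = λ x y → ⟪⟫-comm (f x) (f y)
      ; additive = λ x y z → trans (⟪⟫-cong {y = f z} (Linear.f-+ L x y) (λ _ → refl)) (⟪⟫-+ˡ (f x) (f y) (f z))
      }

    *-form : ∀ {n} a {B : R^ n → R^ n → Carrier} → IsSymmetricForm B → IsSymmetricForm (λ x y → B x y * a)
    *-form a S = record
      { symmetric = λ x y → *-congʳ (symmetric x y)
      ; additive = λ x y z → trans (*-congʳ (additive x y z)) (distribʳ a _ _)
      }
      where open IsSymmetricForm S

    Isometric : ∀ {m n} → (R^ m → R^ n) → Set (c ⊔ ℓ)
    Isometric f = ∀ x → ⟪ f x , f x ⟫ ≈ ⟪ x , x ⟫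

    isometric⇒⟪⟫ : ∀ {m n} {f : R^ m → R^ n} → Linear f → Isometric f → ∀ x y → ⟪ f x , f y ⟫ ≈ ⟪ x , y ⟫
    isometric⇒⟪⟫ L iso = polarize (pullback L) ⟪⟫-form iso

    adjoint : ∀ {m n} → (R^ m → R^ n) → R^ n → R^ m
    adjoint f v l = ⟪ f (ε l) , v ⟫

    module Orthogonal {n} {f : R^ n → R^ n} (L : Linear f) (f-⟪⟫ : ∀ x y → ⟪ f x , f y ⟫ ≈ ⟪ x , y ⟫) where
      open Linear L

      adjoint-f : ∀ x → adjoint f (f x) ≋ x
      adjoint-f x l = trans (f-⟪⟫ (ε l) x) (⟪ε⟫ l x)

      -- The matrix f fᵀ. What is given is the opposite order, fᵀ f = 1.
      gram : Fin n → Fin n → Carrier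
      gram k k′ = sum (λ l → f (ε l) k * f (ε l) k′)

      gram-column : ∀ k l → sum (λ k′ → gram k k′ * f (ε l) k′) ≈ f (ε l) k
      gram-column k l = begin
        sum (λ k′ → gram k k′ * f (ε l) k′)
          ≈⟨ sum-cong-≋ (λ k′ → trans (*-distribʳ-sum (f (ε l) k′) (λ l′ → f (ε l′) k * f (ε l′) k′))
               (sum-cong-≋ {n} λ l′ → *-assoc (f (ε l′) k) (f (ε l′) k′) (f (ε l) k′))) ⟩
        sum (λ k′ → sum (λ l′ → f (ε l′) k * (f (ε l′) k′ * f (ε l) k′)))
          ≈⟨ ∑-comm (λ k′ l′ → f (ε l′) k * (f (ε l′) k′ * f (ε l) k′)) ⟩
        sum (λ l′ → sum (λ k′ → f (ε l′) k * (f (ε l′) k′ * f (ε l) k′)))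
          ≈⟨ sum-cong-≋ (λ l′ → *-distribˡ-sum (f (ε l′) k) (λ k′ → f (ε l′) k′ * f (ε l) k′)) ⟨
        sum (λ l′ → f (ε l′) k * ⟪ f (ε l′) , f (ε l) ⟫)
          ≈⟨ sum-cong-≋ (λ l′ → trans (*-congˡ (trans (f-⟪⟫ (ε l′) (ε l)) (trans (⟪ε⟫ l′ (ε l)) refl))) (*-comm _ _)) ⟩
        sum (λ l′ → ε l l′ * f (ε l′) k)
          ≈⟨ ⟪ε⟫ l (λ l′ → f (ε l′) k) ⟩
        f (ε l) k ∎

      -- A diagonal entry of (f fᵀ)² = f fᵀ, one factor being transposed by symmetry.
      gram-idempotent : ∀ k → sum (λ k′ → gram k k′ * gram k k′) ≈ gram k k
      gram-idempotent k = begin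
        sum (λ k′ → gram k k′ * gram k k′)
          ≈⟨ sum-cong-≋ (λ k′ → *-distribˡ-sum (gram k k′) (λ l → f (ε l) k * f (ε l) k′)) ⟩
        sum (λ k′ → sum (λ l → gram k k′ * (f (ε l) k * f (ε l) k′)))
          ≈⟨ ∑-comm (λ k′ l → gram k k′ * (f (ε l) k * f (ε l) k′)) ⟩
        sum (λ l → sum (λ k′ → gram k k′ * (f (ε l) k * f (ε l) k′)))
          ≈⟨ sum-cong-≋ (λ l → trans (sum-cong-≋ λ k′ → solve 3 (λ g a b → g :* (a :* b) := a :* (g :* b)) refl (gram k k′) (f (ε l) k) (f (ε l) k′))
               (trans (sym (*-distribˡ-sum (f (ε l) k) (λ k′ → gram k k′ * f (ε l) k′))) (*-congˡ (gram-column k l)))) ⟩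
        gram k k ∎

      defect : Fin n → Fin n → Carrier
      defect k k′ = gram k k′ + - ε k k′

      -- Row k of f fᵀ - 1 has squared norm 1 - `gram k k`; the equation is arranged to avoid
      -- subtraction.
      defect-row : ∀ k → sum (λ k′ → defect k k′ * defect k k′) + (gram k k + gram k k) ≈ gram k k + 1#
      defect-row k = begin
        sum (λ k′ → d k′ * d k′) + (gram k k + gram k k)
          ≈⟨ +-congˡ (+-cong diagonal diagonal) ⟨
        sum (λ k′ → d k′ * d k′) + (sum (λ k′ → g k′ * ε k k′) + sum (λ k′ → g k′ * ε k k′))
          ≈⟨ +-congˡ (∑-distrib-+ (λ k′ → g k′ * ε k k′) (λ k′ → g k′ * ε k k′)) ⟨
        sum (λ k′ → d k′ * d k′) + sum (λ k′ → g k′ * ε k k′ + g k′ * ε k k′)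
          ≈⟨ ∑-distrib-+ (λ k′ → d k′ * d k′) (λ k′ → g k′ * ε k k′ + g k′ * ε k k′) ⟨
        sum (λ k′ → d k′ * d k′ + (g k′ * ε k k′ + g k′ * ε k k′))
          ≈⟨ sum-cong-≋ (λ k′ → binomial (g k′) (ε k k′)) ⟩
        sum (λ k′ → g k′ * g k′ + ε k k′ * ε k k′)
          ≈⟨ ∑-distrib-+ (λ k′ → g k′ * g k′) (λ k′ → ε k k′ * ε k k′) ⟩
        sum (λ k′ → g k′ * g k′) + ⟪ ε k , ε k ⟫
          ≈⟨ +-cong (gram-idempotent k) (trans (⟪ε⟫ k (ε k)) (ε-refl k)) ⟩
        gram k k + 1# ∎
        where
        d g : Fin n → Carrier
        d = defect k
        g = gram k
        diagonal : sum (λ k′ → g k′ * ε k k′) ≈ gram k k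
        diagonal = trans (⟪⟫-comm g (ε k)) (⟪ε⟫ k g)
        binomial : ∀ a b → (a + - b) * (a + - b) + (a * b + a * b) ≈ a * a + b * b
        binomial a b = begin
          e * e + (a * b + a * b)              ≈⟨ +-congˡ (+-cong (*-congʳ a≈) (*-congʳ a≈)) ⟩
          e * e + ((e + b) * b + (e + b) * b)
            ≈⟨ solve 2 (λ e b → e :* e :+ ((e :+ b) :* b :+ (e :+ b) :* b) := (e :+ b) :* (e :+ b) :+ b :* b) refl e b ⟩
          (e + b) * (e + b) + b * b            ≈⟨ +-congʳ (*-cong a≈ a≈) ⟨
          a * a + b * b                        ∎
          where
          e : Carrier
          e = a + - b
          a≈ : a ≈ e + b
          a≈ = sym (trans (+-assoc a (- b) b) (trans (+-congˡ (-‿inverseˡ b)) (+-identityʳ a)))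

      trace : sum (λ k → gram k k) ≈ sum {n} (λ _ → 1#)
      trace = trans (∑-comm (λ k l → f (ε l) k * f (ε l) k))
        (sum-cong-≋ λ l → trans (f-⟪⟫ (ε l) (ε l)) (trans (⟪ε⟫ l (ε l)) (ε-refl l)))

      -- f fᵀ is idempotent, so the squared Frobenius norm of f fᵀ - 1 is n - tr (f fᵀ) = n - tr (fᵀ f) = 0.
      gram≈ε : ∀ k k′ → gram k k′ ≈ ε k k′
      gram≈ε k k′ = x∙y⁻¹≈ε⇒x≈y _ _ (definite defect (+-cancelʳ (N + N) _ _ (begin
        sum (λ k → sum (λ k′ → defect k k′ * defect k k′)) + (N + N)
          ≈⟨ +-congˡ (∑-distrib-+ (λ k → gram k k) (λ k → gram k k)) ⟨
        sum (λ k → sum (λ k′ → defect k k′ * defect k k′)) + sum (λ k → gram k k + gram k k)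
          ≈⟨ ∑-distrib-+ (λ k → sum (λ k′ → defect k k′ * defect k k′)) (λ k → gram k k + gram k k) ⟨
        sum (λ k → sum (λ k′ → defect k k′ * defect k k′) + (gram k k + gram k k))
          ≈⟨ sum-cong-≋ defect-row ⟩
        sum (λ k → gram k k + 1#)
          ≈⟨ ∑-distrib-+ (λ k → gram k k) (λ _ → 1#) ⟩
        N + sum {n} (λ _ → 1#)
          ≈⟨ +-congˡ trace ⟨
        N + N
          ≈⟨ +-identityˡ _ ⟨
        0# + (N + N) ∎)) k k′)
        where
        N : Carrier
        N = sum (λ k → gram k k)

      f-adjoint : ∀ v → f (adjoint f v) ≋ v
      f-adjoint v k = begin
        f (adjoint f v) k
          ≈⟨ expand (adjoint f v) k ⟩
        sum (λ l → ⟪ f (ε l) , v ⟫ * f (ε l) k)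
          ≈⟨ sum-cong-≋ (λ l → trans (*-distribʳ-sum (f (ε l) k) (λ k′ → f (ε l) k′ * v k′))
               (sum-cong-≋ λ k′ → solve 3 (λ a b c → a :* b :* c := c :* a :* b) refl (f (ε l) k′) (v k′) (f (ε l) k))) ⟩
        sum (λ l → sum (λ k′ → f (ε l) k * f (ε l) k′ * v k′))
          ≈⟨ ∑-comm (λ l k′ → f (ε l) k * f (ε l) k′ * v k′) ⟩
        sum (λ k′ → sum (λ l → f (ε l) k * f (ε l) k′ * v k′))
          ≈⟨ sum-cong-≋ (λ k′ → *-distribʳ-sum (v k′) (λ l → f (ε l) k * f (ε l) k′)) ⟨
        sum (λ k′ → gram k k′ * v k′)
          ≈⟨ sum-cong-≋ (λ k′ → *-congʳ (gram≈ε k k′)) ⟩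
        ⟪ ε k , v ⟫
          ≈⟨ ⟪ε⟫ k v ⟩
        v k ∎

    -- The Hurwitz equations Aᵢᵀ Aᵢ = 1 and Aᵢᵀ Aⱼ + Aⱼᵀ Aᵢ = 0 in terms of inner products.
    record OrthogonalFamily {r n} (A : Fin r → R^ n → R^ n) : Set (c ⊔ ℓ) where
      field
        linear    : ∀ i → Linear (A i)
        isometric : ∀ i x y → ⟪ A i x , A i y ⟫ ≈ ⟪ x , y ⟫
        skew      : ∀ {i j} → i ≢ j → ∀ x y → ⟪ A i x , A j y ⟫ ≈ - ⟪ A j x , A i y ⟫

    -- E i is the symmetric block matrix with off-diagonal blocks A i and its transpose.
    module Doubling {r n} {A : Fin r → R^ n → R^ n} (F : OrthogonalFamily A) where
      open OrthogonalFamily F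

      Double : Setoid c ℓ
      Double = ×-setoid (≋-setoid n) (≋-setoid n)

      adjoint-cong : ∀ i {v w} → v ≋ w → adjoint (A i) v ≋ adjoint (A i) w
      adjoint-cong i v≋w l = ⟪⟫-cong {x = A i (ε l)} (λ _ → refl) v≋w

      adjoint-skew : ∀ {i j} → i ≢ j → ∀ x → adjoint (A i) (A j x) ≋ -ᵛ adjoint (A j) (A i x)
      adjoint-skew i≢j x l = skew i≢j (ε l) x

      -- Inserting Aⱼ Aⱼᵀ = 1 on the left turns Aᵢ Aⱼᵀ into Aⱼ (Aⱼᵀ Aᵢ) Aⱼᵀ = - Aⱼ Aᵢᵀ (Aⱼ Aⱼᵀ).
      skew-adjoint : ∀ {i j} → i ≢ j → ∀ v → A i (adjoint (A j) v) ≋ -ᵛ A j (adjoint (A i) v)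
      skew-adjoint {i} {j} i≢j v k = begin
        A i w k                            ≈⟨ -‿involutive _ ⟨
        - (- A i w k)
          ≈⟨ -‿cong (-‿cong (Orthogonal.f-adjoint (linear j) (isometric j) (A i w) k)) ⟨
        - (- A j (adjoint (A j) (A i w)) k)  ≈⟨ -‿cong (Linear.f-neg (linear j) _ k) ⟨
        - A j (-ᵛ adjoint (A j) (A i w)) k ≈⟨ -‿cong (Linear.f-cong (linear j) (adjoint-skew i≢j w) k) ⟨
        - A j (adjoint (A i) (A j w)) k
          ≈⟨ -‿cong (Linear.f-cong (linear j) (adjoint-cong i (Orthogonal.f-adjoint (linear j) (isometric j) v)) k) ⟩
        - A j (adjoint (A i) v) k          ∎
        where
        w : R^ n
        w = adjoint (A j) v

      involutions : AnticommutingInvolutions Double r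
      involutions = record
        { neg = λ (u , v) → -ᵛ u , -ᵛ v
        ; neg-cong = λ (p , q) → (λ k → -‿cong (p k)) , (λ k → -‿cong (q k))
        ; neg-involutive = λ (u , v) → (λ k → -‿involutive (u k)) , (λ k → -‿involutive (v k))
        ; E = λ i (u , v) → adjoint (A i) v , A i u
        ; E-cong = λ i (p , q) → adjoint-cong i q , Linear.f-cong (linear i) p
        ; E-neg = λ i (u , v) → (λ l → ⟪⟫-neg (A i (ε l)) v) , Linear.f-neg (linear i) u
        ; E-involutive = λ i (u , v) →
            Orthogonal.adjoint-f (linear i) (isometric i) u , Orthogonal.f-adjoint (linear i) (isometric i) v
        ; E-anticommute = λ i≢j (u , v) → adjoint-skew i≢j u , skew-adjoint i≢j v
        }

    -- Polarising |F(x, y)|² = |x|² |y|² in y gives `scaled`, and polarising that in x gives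
    -- `mixed`, whose right side vanishes for orthogonal arguments.
    normed⇒orthogonalFamily :
      ∀ {h m r} (F : R^ h → R^ m → R^ m) → (∀ y → Linear (λ x → F x y)) → (∀ x → Linear (F x)) →
      (∀ x y → ⟪ F x y , F x y ⟫ ≈ ⟪ x , x ⟫ * ⟪ y , y ⟫) →
      (a : Fin r → R^ h) → (∀ i j → ⟪ a i , a j ⟫ ≈ ε i j) → OrthogonalFamily (λ i → F (a i))
    normed⇒orthogonalFamily {h} {m} F linearˡ linearʳ normed a a-orthonormal = record
      { linear    = λ i → linearʳ (a i)
      ; isometric = λ i x y → trans (scaled (a i) x y)
          (trans (*-congˡ (trans (a-orthonormal i i) (ε-refl i))) (*-identityʳ _))
      ; skew      = λ {i} {j} i≢j x y → +-inverseˡ-unique _ _ (trans (mixed x y (a i) (a j))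
          (trans (*-congʳ (trans (a-orthonormal i j) (ε-≢ i≢j))) (zeroˡ _)))
      }
      where
      scaled : ∀ x y y′ → ⟪ F x y , F x y′ ⟫ ≈ ⟪ y , y′ ⟫ * ⟪ x , x ⟫
      scaled x = polarize (pullback (linearʳ x)) (*-form ⟪ x , x ⟫ ⟪⟫-form)
        (λ y → trans (normed x y) (*-comm _ _))

      -- The second summand, with x and x′ exchanged, makes the form symmetric.
      mixed-form : ∀ y y′ → IsSymmetricForm (λ x x′ → ⟪ F x y , F x′ y′ ⟫ + ⟪ F x′ y , F x y′ ⟫)
      mixed-form y y′ = record
        { symmetric = λ x x′ → +-comm _ _
        ; additive = λ x x′ w → trans
            (+-cong (trans (⟪⟫-cong {y = F w y′} (Linear.f-+ (linearˡ y) x x′) (λ _ → refl)) (⟪⟫-+ˡ (F x y) (F x′ y) (F w y′)))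
              (trans (⟪⟫-comm (F w y) _) (trans (⟪⟫-cong {y = F w y} (Linear.f-+ (linearˡ y′) x x′) (λ _ → refl))
                (trans (⟪⟫-+ˡ (F x y′) (F x′ y′) (F w y)) (+-cong (⟪⟫-comm _ (F w y)) (⟪⟫-comm _ (F w y)))))))
            (solve 4 (λ p q r s → (p :+ q) :+ (r :+ s) := (p :+ r) :+ (q :+ s)) refl _ _ _ _)
        }

      mixed : ∀ y y′ x x′ → ⟪ F x y , F x′ y′ ⟫ + ⟪ F x′ y , F x y′ ⟫ ≈ ⟪ x , x′ ⟫ * (⟪ y , y′ ⟫ + ⟪ y , y′ ⟫)
      mixed y y′ = polarize (mixed-form y y′) (*-form (⟪ y , y′ ⟫ + ⟪ y , y′ ⟫) ⟪⟫-form) λ x → begin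
        ⟪ F x y , F x y′ ⟫ + ⟪ F x y , F x y′ ⟫        ≈⟨ +-cong (scaled x y y′) (scaled x y y′) ⟩
        ⟪ y , y′ ⟫ * ⟪ x , x ⟫ + ⟪ y , y′ ⟫ * ⟪ x , x ⟫
          ≈⟨ solve 2 (λ p q → p :* q :+ p :* q := q :* (p :+ p)) refl ⟪ y , y′ ⟫ ⟪ x , x ⟫ ⟩
        ⟪ x , x ⟫ * (⟪ y , y′ ⟫ + ⟪ y , y′ ⟫)          ∎

    signed : ∀ {n} → Bool → R^ n → R^ n
    signed false x = x
    signed true  x = -ᵛ x

    signed-f : ∀ {m n} {f : R^ m → R^ n} → Linear f → ∀ s x → f (signed s x) ≋ signed s (f x)
    signed-f L false x = λ _ → refl
    signed-f L true  x = Linear.f-neg L x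

    module _ (1≉0 : ¬ 1# ≈ 0#) where

      Orthonormal : ∀ {r n} → (Fin r → R^ n) → Set ℓ
      Orthonormal b = ∀ i j → ⟪ b i , b j ⟫ ≈ ε i j

      orthonormal-injective : ∀ {r n} {b : Fin r → R^ n} → Orthonormal b → ∀ s {i j} →
                              b i ≋ signed s (b j) → i ≡ j
      orthonormal-injective {b = b} orth s {i} {j} eq with i ≟ j
      ... | yes i≡j = i≡j
      ... | no  i≢j = contradiction (begin
        1#                           ≈⟨ ε-refl i ⟨
        ε i i                        ≈⟨ orth i i ⟨
        ⟪ b i , b i ⟫                ≈⟨ ⟪⟫-cong {x = b i} (λ _ → refl) eq ⟩
        ⟪ b i , signed s (b j) ⟫     ≈⟨ vanish s ⟩
        0#                           ∎) 1≉0
        where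
        bᵢbⱼ≈0 : ⟪ b i , b j ⟫ ≈ 0#
        bᵢbⱼ≈0 = trans (orth i j) (ε-≢ i≢j)
        vanish : ∀ s → ⟪ b i , signed s (b j) ⟫ ≈ 0#
        vanish false = bᵢbⱼ≈0
        vanish true  = trans (⟪⟫-neg (b i) (b j)) (trans (-‿cong bᵢbⱼ≈0) -0#≈0#)

      orthonormal-nonzero : ∀ {r n} {b : Fin r → R^ n} → Orthonormal b → ∀ i → ¬ b i ≋ -ᵛ b i
      orthonormal-nonzero {b = b} orth i eq = 1≉0 (halve (begin
        1# + 1#                          ≈⟨ +-cong unit unit ⟨
        ⟪ b i , b i ⟫ + ⟪ b i , b i ⟫    ≈⟨ +-congˡ (trans (⟪⟫-cong {x = b i} (λ _ → refl) eq) (⟪⟫-neg (b i) (b i))) ⟩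
        ⟪ b i , b i ⟫ + - ⟪ b i , b i ⟫  ≈⟨ -‿inverseʳ _ ⟩
        0#                               ≈⟨ +-identityˡ 0# ⟨
        0# + 0#                          ∎))
        where
        unit : ⟪ b i , b i ⟫ ≈ 1#
        unit = trans (orth i i) (ε-refl i)

      no-signed-table : ∀ {n} {A : Fin 10 → R^ n → R^ n} → OrthogonalFamily A →
                        {y : Fin 10 → R^ n} → Orthonormal y → {z : Fin 16 → R^ n} → Orthonormal z →
                        (M : Fin 10 → Fin 10 → Fin 16) (s : Fin 10 → Fin 10 → Bool) →
                        ¬ (∀ i j → A i (y j) ≋ signed (s i j) (z (M i j)))
      no-signed-table {n} {A} F {y} y-orth {z} z-orth M s table =
        Table.no-table involutions left right M
          (λ i j → s i j , Ey (s i j) (table i j))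
          (λ {j} {j′} (t , eq) → orthonormal-injective y-orth t (first t j′ eq))
          (λ k (_ , eq) → orthonormal-nonzero z-orth k eq)
        where
        open Doubling F
        open Words involutions using (sgn)
        open Setoid Double using () renaming (_≈_ to _≈ᵈ_)
        𝟎 : R^ n
        𝟎 _ = 0#
        left : Fin 10 → R^ n × R^ n
        left j = y j , 𝟎
        right : Fin 16 → R^ n × R^ n
        right k = 𝟎 , z k
        Ey : ∀ {i j} t → A i (y j) ≋ signed t (z (M i j)) →
             (adjoint (A i) 𝟎 , A i (y j)) ≈ᵈ sgn t (right (M i j))
        Ey {i} false eq = (λ l → ⟪⟫-zeroʳ (A i (ε l)) (λ _ → refl)) , eq
        Ey {i} true  eq = (λ l → trans (⟪⟫-zeroʳ (A i (ε l)) (λ _ → refl)) (sym -0#≈0#)) , eq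
        first : ∀ t {j} j′ → left j ≈ᵈ sgn t (left j′) → y j ≋ signed t (y j′)
        first false _ = proj₁
        first true  _ = proj₁

-- Real numbers

module R = CommutativeRing ℝ-commutativeRing
open InnerProduct ℝ-commutativeRing
open import Algebra.Properties.Semiring.Sum R.semiring using (sum)

-- Not invariant under `_≃_`, but true of sums of squares as they are built, so that definiteness
-- can be shown term by term in the rationals.
PointwiseNonNeg : ℝ → Set
PointwiseNonNeg x = ∀ N → 0ℚ ℚ.≤ seq x N

∣q∣*∣q∣≡q*q : ∀ q → ∣ q ∣ ℚ.* ∣ q ∣ ≡ q ℚ.* q
∣q∣*∣q∣≡q*q q with ℚ.∣p∣≡p∨∣p∣≡-p q
... | inj₁ eq rewrite eq = ≡.refl
... | inj₂ eq rewrite eq = solve 1 (λ q → (:- q) :* (:- q) := q :* q) ≡.refl q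
  where open +-*-Solver

square-nonNeg : ∀ x → PointwiseNonNeg (x *ᴿ x)
square-nonNeg x N = subst (0ℚ ℚ.≤_) (∣q∣*∣q∣≡q*q q)
  (ℚ.nonNegative⁻¹ _ {{ℚ.nonNeg*nonNeg⇒nonNeg (∣ q ∣) {{∣q∣≥0}} (∣ q ∣) {{∣q∣≥0}}}})
  where
  q : ℚ
  q = seq x N
  ∣q∣≥0 : ℚ.NonNegative (∣ q ∣)
  ∣q∣≥0 = ℚ.nonNegative (ℚ.0≤∣p∣ q)

sum-nonNeg : ∀ {n} (f : Fin n → ℝ) → (∀ i → PointwiseNonNeg (f i)) → PointwiseNonNeg (sum f)
sum-nonNeg {zero}  f h N = ℚ.≤-refl
sum-nonNeg {suc n} f h N = ℚ.+-mono-≤ (h zero N) (sum-nonNeg (f ∘ suc) (h ∘ suc) N)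

summand≤sum : ∀ {n} (f : Fin n → ℝ) → (∀ i → PointwiseNonNeg (f i)) → ∀ i N → seq (f i) N ℚ.≤ seq (sum f) N
summand≤sum f h zero    N = subst (ℚ._≤ seq (sum f) N) (ℚ.+-identityʳ _)
  (ℚ.+-monoʳ-≤ (seq (f zero) N) (sum-nonNeg (f ∘ suc) (h ∘ suc) N))
summand≤sum f h (suc i) N = subst (ℚ._≤ seq (sum f) N) (ℚ.+-identityˡ _)
  (ℚ.+-mono-≤ (h zero N) (summand≤sum (f ∘ suc) (h ∘ suc) i N))

square<⇒∣∣< : ∀ q {ε} → 0ℚ ℚ.< ε → q ℚ.* q ℚ.< ε ℚ.* ε → ∣ q ∣ ℚ.< ε
square<⇒∣∣< q {ε} 0<ε q²<ε² with ∣ q ∣ ℚ.<? ε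
... | yes ∣q∣<ε = ∣q∣<ε
... | no  ∣q∣≮ε = contradiction (ℚ.<-≤-trans q²<ε² (subst (ε ℚ.* ε ℚ.≤_) (∣q∣*∣q∣≡q*q q)
  (ℚ.≤-trans (ℚ.*-monoˡ-≤-nonNeg ε {{ℚ.nonNegative (ℚ.<⇒≤ 0<ε)}} ε≤∣q∣)
    (ℚ.*-monoʳ-≤-nonNeg ∣ q ∣ {{ℚ.nonNegative (ℚ.0≤∣p∣ q)}} ε≤∣q∣)))) (ℚ.<-irrefl ≡.refl)
  where
  ε≤∣q∣ : ε ℚ.≤ ∣ q ∣
  ε≤∣q∣ = ℚ.≮⇒≥ ∣q∣≮ε

p-0≡p : ∀ p → p ℚ.- 0ℚ ≡ p
p-0≡p p = ℚ.+-identityʳ p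

-- Each square is at most the total, so a total below ε² keeps every entry below ε.
sumOfSquares-definite : ∀ {m n} (x : Fin m → Fin n → ℝ) →
                        sum (λ i → sum (λ j → x i j *ᴿ x i j)) ≃ fromℚ 0ℚ → ∀ i j → x i j ≃ fromℚ 0ℚ
sumOfSquares-definite x h i j ε 0<ε =
  let N , small = h (ε ℚ.* ε) (ℚ.positive⁻¹ _ {{ℚ.pos*pos⇒pos ε {{ℚ.positive 0<ε}} ε {{ℚ.positive 0<ε}}}})
  in N , λ n N≤n → subst (λ q → ∣ q ∣ ℚ.< ε) (≡.sym (p-0≡p (seq (x i j) n)))
    (square<⇒∣∣< (seq (x i j) n) 0<ε (ℚ.≤-<-trans (bound n)
      (subst (ℚ._< ε ℚ.* ε) (≡.trans (cong ∣_∣ (p-0≡p (seq total n))) (ℚ.0≤p⇒∣p∣≡p (sum-nonNeg _ rows≥0 n))) (small n N≤n))))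
  where
  rows : _ → ℝ
  rows i = sum (λ j → x i j *ᴿ x i j)
  total : ℝ
  total = sum rows
  rows≥0 : ∀ i → PointwiseNonNeg (rows i)
  rows≥0 i = sum-nonNeg _ (λ j → square-nonNeg (x i j))
  bound : ∀ n → seq (x i j *ᴿ x i j) n ℚ.≤ seq total n
  bound n = ℚ.≤-trans (summand≤sum _ (λ j → square-nonNeg (x i j)) j n) (summand≤sum rows rows≥0 i n)

open FormallyReal (λ {m} {n} → sumOfSquares-definite {m} {n})

pointwiseNonNeg⇒NonNegᴿ : ∀ x → PointwiseNonNeg x → NonNegᴿ x
pointwiseNonNeg⇒NonNegᴿ x h ε 0<ε = 0 , λ n _ → ℚ.+-mono-≤-< (h n) 0<ε

∥∥-square : ∀ {n} (x : R^ n) → ∥ x ∥ *ᴿ ∥ x ∥ ≃ ⟪ x , x ⟫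
∥∥-square x = √-square {⟪ x , x ⟫} (pointwiseNonNeg⇒NonNegᴿ ⟪ x , x ⟫ (sum-nonNeg _ λ i → square-nonNeg (x i)))

fromℚ-injective : ∀ {p q} → fromℚ p ≃ fromℚ q → p ≡ q
fromℚ-injective {p} {q} h with p ℚ.≟ q
... | yes p≡q = p≡q
... | no  p≢q =
  -- For constant sequences, this choice of ε makes |p - q| smaller than itself.
  let N , small = h ∣ p ℚ.- q ∣ 0<∣p-q∣ in contradiction (small N ℕ.≤-refl) (ℚ.<-irrefl ≡.refl)
  where
  0<∣p-q∣ : 0ℚ ℚ.< ∣ p ℚ.- q ∣
  0<∣p-q∣ with 0ℚ ℚ.<? ∣ p ℚ.- q ∣
  ... | yes 0< = 0<
  ... | no  0≮ = contradiction (ℚ-group.x∙y⁻¹≈ε⇒x≈y p q (ℚ.∣p∣≡0⇒p≡0 _ (ℚ.≤-antisym (ℚ.≮⇒≥ 0≮) (ℚ.0≤∣p∣ _)))) p≢q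
    where import Algebra.Properties.Group (CommutativeRing.+-group ℚ.+-*-commutativeRing) as ℚ-group

fromℚ-cong : ∀ {p q} → p ≡ q → fromℚ p ≃ fromℚ q
fromℚ-cong {p} ≡.refl = R.refl {fromℚ p}

toℚᵘ-/1 : ∀ i → ℚ.toℚᵘ (i / 1) ℚᵘ.≃ ℚᵘ.mkℚᵘ i 0
toℚᵘ-/1 i = ℚ.toℚᵘ-fromℚᵘ (ℚᵘ.mkℚᵘ i 0)

/1-injective : ∀ {i j} → i / 1 ≡ j / 1 → i ≡ j
/1-injective {i} {j} eq with ℚᵘ.*≡* i*1≡j*1 ← ℚ./-injective-≃ (ℚᵘ.mkℚᵘ i 0) (ℚᵘ.mkℚᵘ j 0) eq =
  ℤ.*-cancelʳ-≡ i j (+ 1) i*1≡j*1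

/1-+ : ∀ i j → (i / 1) ℚ.+ (j / 1) ≡ (i ℤ.+ j) / 1
/1-+ i j = ℚ.toℚᵘ-injective (begin
  ℚ.toℚᵘ ((i / 1) ℚ.+ (j / 1))                  ≈⟨ ℚ.toℚᵘ-homo-+ (i / 1) (j / 1) ⟩
  ℚ.toℚᵘ (i / 1) ℚᵘ.+ ℚ.toℚᵘ (j / 1)        ≈⟨ ℚᵘ.+-cong (toℚᵘ-/1 i) (toℚᵘ-/1 j) ⟩
  ℚᵘ.mkℚᵘ i 0 ℚᵘ.+ ℚᵘ.mkℚᵘ j 0
    ≈⟨ ℚᵘ.*≡* (cong (ℤ._* + 1) (cong₂ ℤ._+_ (ℤ.*-identityʳ i) (ℤ.*-identityʳ j))) ⟩
  ℚᵘ.mkℚᵘ (i ℤ.+ j) 0                       ≈⟨ toℚᵘ-/1 (i ℤ.+ j) ⟨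
  ℚ.toℚᵘ ((i ℤ.+ j) / 1)                    ∎)
  where open import Relation.Binary.Reasoning.Setoid ℚᵘ.≃-setoid

/1-* : ∀ i j → (i / 1) ℚ.* (j / 1) ≡ (i ℤ.* j) / 1
/1-* i j = ℚ.toℚᵘ-injective (begin
  ℚ.toℚᵘ ((i / 1) ℚ.* (j / 1))                  ≈⟨ ℚ.toℚᵘ-homo-* (i / 1) (j / 1) ⟩
  ℚ.toℚᵘ (i / 1) ℚᵘ.* ℚ.toℚᵘ (j / 1)        ≈⟨ ℚᵘ.*-cong (toℚᵘ-/1 i) (toℚᵘ-/1 j) ⟩
  ℚᵘ.mkℚᵘ (i ℤ.* j) 0                       ≈⟨ toℚᵘ-/1 (i ℤ.* j) ⟨
  ℚ.toℚᵘ ((i ℤ.* j) / 1)                    ∎)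
  where open import Relation.Binary.Reasoning.Setoid ℚᵘ.≃-setoid

-- Integer vectors of square norm one

squareNorm : ∀ {n} → (Fin n → ℤ) → ℕ
squareNorm {zero}  c = 0
squareNorm {suc n} c = ℤ.∣ c zero ∣ ℕ.* ℤ.∣ c zero ∣ ℕ.+ squareNorm (c ∘ suc)

i*i≡+∣i∣*∣i∣ : ∀ i → i ℤ.* i ≡ + (ℤ.∣ i ∣ ℕ.* ℤ.∣ i ∣)
i*i≡+∣i∣*∣i∣ (+ n)    = ≡.sym (ℤ.pos-* n n)
i*i≡+∣i∣*∣i∣ -[1+ n ] = ≡.refl

fromℤ-squareNorm : ∀ {n} (c : Fin n → ℤ) → ⟪ fromℤ ∘ c , fromℤ ∘ c ⟫ ≃ fromℤ (+ squareNorm c)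
fromℤ-squareNorm c = pointwise {⟪ fromℤ ∘ c , fromℤ ∘ c ⟫} {fromℤ (+ squareNorm c)} (λ N → go c N)
  where
  go : ∀ {n} (c : Fin n → ℤ) N → seq ⟪ fromℤ ∘ c , fromℤ ∘ c ⟫ N ≡ + squareNorm c / 1
  go {zero}  c N = ≡.refl
  go {suc n} c N = ≡.trans
    (cong₂ ℚ._+_ (≡.trans (/1-* (c zero) (c zero)) (cong (_/ 1) (i*i≡+∣i∣*∣i∣ (c zero)))) (go (c ∘ suc) N))
    (/1-+ (+ (ℤ.∣ c zero ∣ ℕ.* ℤ.∣ c zero ∣)) (+ squareNorm (c ∘ suc)))

squareNorm≡0 : ∀ {n} (c : Fin n → ℤ) → squareNorm c ≡ 0 → ∀ i → c i ≡ + 0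
squareNorm≡0 {suc n} c eq zero    with ℕ.m*n≡0⇒m≡0∨n≡0 ℤ.∣ c zero ∣ (ℕ.m+n≡0⇒m≡0 (ℤ.∣ c zero ∣ ℕ.* ℤ.∣ c zero ∣) eq)
... | inj₁ c₀≡0 = ℤ.∣i∣≡0⇒i≡0 c₀≡0
... | inj₂ c₀≡0 = ℤ.∣i∣≡0⇒i≡0 c₀≡0
squareNorm≡0 {suc n} c eq (suc i) = squareNorm≡0 (c ∘ suc) (ℕ.m+n≡0⇒n≡0 (ℤ.∣ c zero ∣ ℕ.* ℤ.∣ c zero ∣) eq) i

IsSignedUnit : ∀ {n} → (Fin n → ℤ) → Bool → Fin n → Set
IsSignedUnit c s k = (c k ≡ (if s then ℤ.-1ℤ else ℤ.1ℤ)) × (∀ j → j ≢ k → c j ≡ + 0)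

∣i∣≡1⇒unit : ∀ i → ℤ.∣ i ∣ ≡ 1 → ∃ λ s → i ≡ (if s then ℤ.-1ℤ else ℤ.1ℤ)
∣i∣≡1⇒unit (+ 1)    ≡.refl = false , ≡.refl
∣i∣≡1⇒unit -[1+ 0 ] ≡.refl = true , ≡.refl

-- A leading entry of absolute value at least two makes the sum reduce to the form 2 + n, so only 0
-- and 1 remain.
squareNorm≡1 : ∀ {n} (c : Fin n → ℤ) → squareNorm c ≡ 1 → ∃₂ (IsSignedUnit c)
squareNorm≡1 {suc n} c eq with ℤ.∣ c zero ∣ in c₀
... | 0 = let s , k , cₖ , rest = squareNorm≡1 (c ∘ suc) eq in s , suc k , cₖ , λ where
  zero    _     → ℤ.∣i∣≡0⇒i≡0 c₀
  (suc j) j≢k   → rest j (j≢k ∘ cong suc)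
... | 1 = let s , eq′ = ∣i∣≡1⇒unit (c zero) c₀ in s , zero , eq′ , λ where
  zero    0≢0 → contradiction ≡.refl 0≢0
  (suc j) _   → squareNorm≡0 (c ∘ suc) (ℕ.suc-injective eq) j

1≄0 : ¬ fromℚ 1ℚ ≃ fromℚ 0ℚ
1≄0 h with () ← fromℚ-injective {1ℚ} {0ℚ} h

signedUnit⇒ε : ∀ {n} (c : Fin n → ℤ) {s k} → IsSignedUnit c s k → ∀ j → fromℤ (c j) ≃ signed s (ε k) j
signedUnit⇒ε c {s} {k} (cₖ , c≡0) j = go (k ≟ j)
  where
  value : ∀ s {q} → ε k j ≃ fromℚ q → signed s (ε k) j ≃ fromℚ (if s then ℚ.- q else q)
  value false     eq = eq
  value true  {q} eq = R.trans { -ᴿ ε k j} { -ᴿ fromℚ q} {fromℚ (ℚ.- q)} (R.-‿cong {ε k j} {fromℚ q} eq)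
    (pointwise { -ᴿ fromℚ q} {fromℚ (ℚ.- q)} λ _ → ≡.refl)
  match : ∀ {i q} → i / 1 ≡ (if s then ℚ.- q else q) → ε k j ≃ fromℚ q → fromℤ i ≃ signed s (ε k) j
  match {i} {q} eq e = R.trans {fromℤ i} {fromℚ (if s then ℚ.- q else q)} {signed s (ε k) j} (fromℚ-cong eq)
    (R.sym {signed s (ε k) j} {fromℚ (if s then ℚ.- q else q)} (value s e))
  one : ∀ s → (if s then ℤ.-1ℤ else ℤ.1ℤ) / 1 ≡ (if s then ℚ.- 1ℚ else 1ℚ)
  one false = ≡.refl
  one true  = ≡.refl
  nil : ∀ s → + 0 / 1 ≡ (if s then ℚ.- 0ℚ else 0ℚ)
  nil false = ≡.refl
  nil true  = ≡.refl
  go : Dec (k ≡ j) → fromℤ (c j) ≃ signed s (ε k) j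
  go (yes ≡.refl) = match {c k} {1ℚ} (≡.trans (cong (_/ 1) cₖ) (one s)) (ε-refl k)
  go (no  k≢j)  = match {c j} {0ℚ} (≡.trans (cong (_/ 1) (c≡0 j (k≢j ∘ ≡.sym))) (nil s)) (ε-≢ k≢j)

∥∥-cong⇒⟪⟫ : ∀ {m n} (x : R^ m) (y : R^ n) → ∥ x ∥ ≃ ∥ y ∥ → ⟪ x , x ⟫ ≃ ⟪ y , y ⟫
∥∥-cong⇒⟪⟫ x y eq = R.trans {⟪ x , x ⟫} {∥ x ∥ *ᴿ ∥ x ∥} {⟪ y , y ⟫} (R.sym {∥ x ∥ *ᴿ ∥ x ∥} {⟪ x , x ⟫} (∥∥-square x))
  (R.trans {∥ x ∥ *ᴿ ∥ x ∥} {∥ y ∥ *ᴿ ∥ y ∥} {⟪ y , y ⟫} (R.*-cong {∥ x ∥} {∥ y ∥} {∥ x ∥} {∥ y ∥} eq eq) (∥∥-square y))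

linear : ∀ {m n} {f : R^ m → R^ n} → IsLinear f → Linear f
linear L = record
  { f-cong = λ {x} {y} → L.⟦⟧-cong {x} {y} ; f-+ = L.+ᴹ-homo ; f-· = L.*ₗ-homo }
  where module L = LeftModuleMorphisms.IsLeftModuleHomomorphism L

isometry-orthonormal : ∀ {m n} {f : R^ m → R^ n} → IsLinear f → (∀ x → ∥ f x ∥ ≃ ∥ x ∥) →
                       ∀ i j → ⟪ f (ε i) , f (ε j) ⟫ ≃ ε i j
isometry-orthonormal {f = f} L iso i j = R.trans {⟪ f (ε i) , f (ε j) ⟫} {⟪ ε i , ε j ⟫} {ε i j}
  (isometric⇒⟪⟫ (linear L) (λ x → ∥∥-cong⇒⟪⟫ (f x) x (iso x)) (ε i) (ε j))
  (R.trans {⟪ ε i , ε j ⟫} {ε j i} {ε i j} (⟪ε⟫ i (ε j)) (ε-sym j i))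

normed⇒⟪⟫ : ∀ {r s n} (F : NormedBilinearMap r s n) x y →
            ⟪ F ⟨ x , y ⟩ , F ⟨ x , y ⟩ ⟫ ≃ ⟪ x , x ⟫ *ᴿ ⟪ y , y ⟫
normed⇒⟪⟫ F x y = begin
  ⟪ v , v ⟫                                    ≈⟨ ∥∥-square v ⟨
  ∥ v ∥ *ᴿ ∥ v ∥
    ≈⟨ R.*-cong {∥ v ∥} {∥ x ∥ *ᴿ ∥ y ∥} {∥ v ∥} {∥ x ∥ *ᴿ ∥ y ∥} (NormedBilinearMap.normed F x y) (NormedBilinearMap.normed F x y) ⟩
  (∥ x ∥ *ᴿ ∥ y ∥) *ᴿ (∥ x ∥ *ᴿ ∥ y ∥)         ≈⟨ interchange (∥ x ∥) (∥ y ∥) (∥ x ∥) (∥ y ∥) ⟩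
  (∥ x ∥ *ᴿ ∥ x ∥) *ᴿ (∥ y ∥ *ᴿ ∥ y ∥)
    ≈⟨ R.*-cong {∥ x ∥ *ᴿ ∥ x ∥} {⟪ x , x ⟫} {∥ y ∥ *ᴿ ∥ y ∥} {⟪ y , y ⟫} (∥∥-square x) (∥∥-square y) ⟩
  ⟪ x , x ⟫ *ᴿ ⟪ y , y ⟫                       ∎
  where
  v : R^ _
  v = F ⟨ x , y ⟩
  open import Relation.Binary.Reasoning.Setoid R.setoid
  open import Algebra.Properties.CommutativeSemigroup R.*-commutativeSemigroup using (interchange)

-- The colour table of an integral restriction

module IntegerRestriction
  (g : NormedBilinearMap 10 10 16) (integral : HasIntegerCoefficients g)
  {h m} (F : NormedBilinearMap h m m) (res : g IsRestrictionOf F) where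

  open Restriction res using (α; β; γ; γ∘g≈F∘α,β)
  module α = LinearIsometryOnto α
  module β = LinearIsometryOnto β
  module γ = LinearIsometryOnto γ
  module F = NormedBilinearMap F

  coefficient : Fin 10 → Fin 10 → Fin 16 → ℤ
  coefficient i j k = proj₁ integral k i j

  g-ε : ∀ i j k → (g ⟨ ε i , ε j ⟩) k ≃ fromℤ (coefficient i j k)
  g-ε i j k = R.trans {(g ⟨ ε i , ε j ⟩) k}
    {sum (λ i′ → sum (λ j′ → fromℤ (coefficient i′ j′ k) *ᴿ (ε i i′ *ᴿ ε j j′)))}
    {fromℤ (coefficient i j k)}
    (proj₂ integral (ε i) (ε j) k) (bilinear-ε (λ i j → fromℤ (coefficient i j k)) i j)

  -- `g` sends two standard unit vectors to a unit vector. Its entries are integers, so the equation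
  -- between reals descends to the natural numbers.
  squareNorm-coefficient : ∀ i j → squareNorm (coefficient i j) ≡ 1
  squareNorm-coefficient i j = ℤ.+-injective (/1-injective (fromℚ-injective (begin
    fromℤ (+ squareNorm (coefficient i j))                   ≈⟨ fromℤ-squareNorm (coefficient i j) ⟨
    ⟪ fromℤ ∘ coefficient i j , fromℤ ∘ coefficient i j ⟫
      ≈⟨ ⟪⟫-cong {x = v} {fromℤ ∘ coefficient i j} {v} {fromℤ ∘ coefficient i j} (g-ε i j) (g-ε i j) ⟨
    ⟪ v , v ⟫                                                ≈⟨ normed⇒⟪⟫ g (ε i) (ε j) ⟩
    ⟪ ε {10} i , ε i ⟫ *ᴿ ⟪ ε {10} j , ε j ⟫
      ≈⟨ R.*-cong {⟪ ε {10} i , ε i ⟫} {fromℚ 1ℚ} {⟪ ε {10} j , ε j ⟫} {fromℚ 1ℚ} (unit i) (unit j) ⟩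
    fromℚ 1ℚ *ᴿ fromℚ 1ℚ                                     ≈⟨ R.*-identityˡ (fromℚ 1ℚ) ⟩
    fromℚ 1ℚ                                                 ∎)))
    where
    open import Relation.Binary.Reasoning.Setoid R.setoid
    v : R^ 16
    v = g ⟨ ε i , ε j ⟩
    unit : ∀ (i : Fin 10) → ⟪ ε i , ε i ⟫ ≃ fromℚ 1ℚ
    unit i = R.trans {⟪ ε i , ε i ⟫} {ε i i} {fromℚ 1ℚ} (⟪ε⟫ i (ε i)) (ε-refl i)

  family : OrthogonalFamily (λ i → F.map (α.map (ε i)))
  family = normed⇒orthogonalFamily F.map (λ y → linear (F.linearˡ y)) (λ x → linear (F.linearʳ x)) (normed⇒⟪⟫ F)
    (α.map ∘ ε) (isometry-orthonormal α.linear α.isometric)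

  impossible : (∀ i j → ∃₂ (IsSignedUnit (coefficient i j))) → ⊥
  impossible units = no-signed-table 1≄0 family
    (isometry-orthonormal β.linear β.isometric) (isometry-orthonormal γ.linear γ.isometric)
    (λ i j → proj₁ (proj₂ (units i j))) (λ i j → proj₁ (units i j))
    (λ i j → table i j (proj₂ (proj₂ (units i j))))
    where
    table : ∀ i j {s k} → IsSignedUnit (coefficient i j) s k →
            ∀ l → F.map (α.map (ε i)) (β.map (ε j)) l ≃ signed s (γ.map (ε k)) l
    table i j {s} {k} unit l = begin
      F.map (α.map (ε i)) (β.map (ε j)) l    ≈⟨ γ∘g≈F∘α,β (ε i) (ε j) l ⟨
      γ.map (g ⟨ ε i , ε j ⟩) l              ≈⟨ Linear.f-cong L {g ⟨ ε i , ε j ⟩} {signed s (ε k)} (g≈ε unit) l ⟩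
      γ.map (signed s (ε k)) l               ≈⟨ signed-f L s (ε k) l ⟩
      signed s (γ.map (ε k)) l               ∎
      where
      open import Relation.Binary.Reasoning.Setoid R.setoid
      L : Linear γ.map
      L = linear γ.linear
      g≈ε : IsSignedUnit (coefficient i j) s k → ∀ k′ → (g ⟨ ε i , ε j ⟩) k′ ≃ signed s (ε k) k′
      g≈ε unit k′ = R.trans {(g ⟨ ε i , ε j ⟩) k′} {fromℤ (coefficient i j k′)} {signed s (ε k) k′}
        (g-ε i j k′) (signedUnit⇒ε (coefficient i j) unit k′)

corollary1 : (g : NormedBilinearMap 10 10 16) → HasIntegerCoefficients g →
    (F : HurwitzRadonFormula) → ¬ (g IsRestrictionOf (HurwitzRadonFormula.formula F))
corollary1 g integral F res = impossible λ i j → squareNorm≡1 (coefficient i j) (squareNorm-coefficient i j)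
  where open IntegerRestriction g integral (HurwitzRadonFormula.formula F) res
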